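{- For every $n>0$, the $F$-triangle $F_n(x,y)$ associated with the Hochschild lattice $\mathrm{Hoch}(n)$ satisfies $$F_n(x,y)=\sum_{(u,A)}x^{\,n-|A|-\widetilde{\mathrm{neg}}(u,A)}\,y^{\,\widetilde{\mathrm{neg}}(u,A)},$$ where the sum runs over all pairs $(u,A)$ with $u\in\mathrm{Tri}(n)$ and $A$ a subset of the set $\mathrm{Cov}_\downarrow(u)$ of elements covered by $u$ in $\mathrm{Hoch}(n)$.
   Context: Hochschild lattice. For $n\geq 1$, a triword of length $n$ is a tuple $u=(u_1,\ldots,u_n)$ such that (T1) $u_i\in\{0,1,2\}$ for all $i$; (T2) $u_1\neq 2$; (T3) if $u_i=0$, then $u_j\neq 1$ for all $j>i$. Let $\mathrm{Tri}(n)$ be the set of all triwords of length $n$. The Hochschild lattice is $\mathrm{Hoch}(n)=(\mathrm{Tri}(n),\leq)$ where $\leq$ is the componentwise order. It is known to be a semidistributive lattice: the join is the componentwise maximum, and the meet is obtained by taking the componentwise minimum and then replacing by $0$ every entry $1$ that has an entry $0$ somewhere to its left. Labels and core label order. Let $L$ be a finite semidistributive lattice. For a cover relation $a\lessdot b$ put $\lambda(a,b)=\min\{c\in L\mid a\vee c=b\}$; this minimum exists and is join irreducible. The canonical join representation of $a\in L$ is $\mathrm{Can}(a)=\{\lambda(b,a)\mid b\lessdot a\}$, and $b\mapsto\lambda(b,a)$ is a bijection from $\mathrm{Cov}_\downarrow(a)=\{b\in L\mid b\lessdot a\}$ to $\mathrm{Can}(a)$. The nucleus of $a$ is $a_\downarrow=a\wedge\bigwedge_{b\lessdot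 a}b$. The core label set of $a$ is $\Psi(a)=\{\lambda(b,b')\mid a_\downarrow\leq b\lessdot b'\leq a\}$. The map $a\mapsto\Psi(a)$ is injective. The core label order $\mathrm{CLO}(L)$ is the poset $(L,\sqsubseteq)$ where $a\sqsubseteq b$ if and only if $\Psi(a)\subseteq\Psi(b)$. $F$-triangle. The poset $\mathrm{CLO}(\mathrm{Hoch}(n))$ is graded with least element $(0,\ldots,0)$; let $\mathrm{rk}$ be its rank function (so $\mathrm{rk}(0,\ldots,0)=0$) and $\mu_n$ its Möbius function (with $\mu_n(u,v)=0$ if $u\not\sqsubseteq v$). Define $$M_n(x,y)=\sum_{u,v\in\mathrm{Tri}(n)}\mu_n(u,v)\,x^{\mathrm{rk}(u)}y^{\mathrm{rk}(v)},\qquad F_n(x,y)=y^n M_n\left(\frac{y+1}{y-x},\frac{y-x}{y}\right).$$ The statistic. Let $\mathrm{Atom}(n)$ be the set of atoms of $\mathrm{Hoch}(n)$: $(1,0,\ldots,0)$ and, for $2\leq i\leq n$, the tuple with a $2$ in position $i$ and zeros elsewhere. Put $\mathrm{neg}(u)=|\mathrm{Can}(u)\cap\mathrm{Atom}(n)|$ and, for $A\subseteq\mathrm{Cov}_\downarrow(u)$, $$\widetilde{\mathrm{neg}}(u,A)=\mathrm{neg}(u)-\bigl|\{u'\in A\mid\lambda(u',u)\in\mathrm{Atom}(n)\}\bigr|.$$ The pair $(u,A)$ represents the partial core of $u$ with respect to $A$, i.e. the interval $[u\wedge\bigwedge_{u'\in A}u',\,u]$ of $\mathrm{Hoch}(n)$.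 -}

module Defs where

open import Level using (0ℓ)
open import Algebra.Bundles using (CommutativeRing)
open import Data.Nat.Base using (ℕ; zero; suc; _∸_; z≤n; s≤s)
import Data.Nat.Properties as ℕ
open import Data.Integer.Base as ℤ using (ℤ; 0ℤ; 1ℤ)
open import Data.Fin.Base as Fin using (Fin; toℕ)
open import Data.Fin.Patterns using (0F; 1F; 2F)
import Data.Fin.Properties as Fin
open import Data.List.Base
  using (List; []; _∷_; _++_; map; foldr; filter; length; mapMaybe; allFin; cartesianProductWith)
open import Data.List.Membership.Propositional using (_∈_)
open import Data.List.Membership.Propositional.Properties
  using (∈-allFin; ∈-cartesianProductWith⁺)
import Data.List.Relation.Unary.All as All
import Data.List.Relation.Unary.All.Properties as All
import Data.List.Relation.Unary.Any as Any
import Data.List.Relation.Unary.Any.Properties as Any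
open import Data.List.Relation.Unary.AllPairs using ([]; _∷_)
open import Data.List.Relation.Unary.Unique.Propositional using (Unique)
import Data.List.Relation.Unary.Unique.Propositional.Properties as Unique
open import Data.Maybe.Base using (Maybe; just; nothing)
import Data.Maybe.Relation.Unary.All as MAll
import Data.Maybe.Relation.Unary.Any as MAny
open import Data.Product using (_×_; _,_; proj₁; proj₂; ∃; ∃-syntax)
open import Data.Sum using (inj₁; inj₂)
open import Data.Vec.Base as Vec using (Vec; []; _∷_; lookup; tabulate; replicate)
import Data.Vec.Properties as Vec
open import Function using (_∘_)
open import Relation.Nullary using (¬_; Dec; yes; no; contradiction; recompute)
open import Relation.Nullary.Decidable using (map′; ¬?; _×-dec_; _→-dec_)
open import Relation.Unary as Unary using (Pred; _⊆_)
open import Relation.Binary using (Rel; Decidable; DecidableEquality; Minimum)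
import Relation.Binary.Construct.NonStrictToStrict as Strict
open import Relation.Binary.Lattice.Structures using (IsLattice)
open import Relation.Binary.PropositionalEquality
  using (_≡_; _≢_; refl; sym; trans; cong; cong₂; subst; isEquivalence)
import Algebra.Construct.NaturalChoice.Max as Max
import Algebra.Construct.NaturalChoice.Min as Min
import Algebra.Definitions.RawMonoid as RawMonoid
import Algebra.Properties.Semiring.Exp as Exp

record Finite (A : Set) : Set where
  infix 4 _≟_
  field
    elements : List A
    complete : ∀ a → a ∈ elements
    unique   : Unique elements
    _≟_      : DecidableEquality A

  all? : {P : Pred A 0ℓ} → Unary.Decidable P → Dec (∀ a → P a)
  all? P? = map′ (λ ps a → All.lookup ps (complete a)) (λ f → All.universal f elements)
                 (All.all? P? elements)

  any? : {P : Pred A 0ℓ} → Unary.Decidable P → Dec (∃ P)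
  any? P? = map′ Any.satisfied
                 (λ { (a , pa) → Any.map (λ { refl → pa }) (complete a) })
                 (Any.any? P? elements)

-- The elements of subsets xs enumerate the subsets of the underlying set of xs
-- exactly once when xs has no repetitions.
subsets : {A : Set} → List A → List (List A)
subsets []       = [] ∷ []
subsets (x ∷ xs) = subsets xs ++ map (x ∷_) (subsets xs)

sumℤ : List ℤ → ℤ
sumℤ = foldr ℤ._+_ 0ℤ

module FiniteOrder {A : Set} (finite : Finite A)
                   {_≤_ : Rel A 0ℓ} (_≤?_ : Decidable _≤_) where
  open Finite finite

  infix 4 _<_ _<?_ _⋖_ _⋖?_

  _<_ : Rel A 0ℓ
  _<_ = Strict._<_ _≡_ _≤_

  _<?_ : Decidable _<_
  _<?_ = Strict.<-decidable _≡_ _≤_ _≟_ _≤?_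

  _⋖_ : Rel A 0ℓ
  a ⋖ b = a < b × (∀ c → ¬ (a < c × c < b))

  _⋖?_ : Decidable _⋖_
  a ⋖? b = (a <? b) ×-dec all? (λ c → ¬? ((a <? c) ×-dec (c <? b)))

  record IsRankFunction (bottom : A) (rk : A → ℕ) : Set where
    field
      rk-bottom : rk bottom ≡ 0
      rk-cover  : ∀ {a b} → a ⋖ b → rk b ≡ suc (rk a)

  record IsMöbiusFunction (μ : A → A → ℤ) : Set where
    field
      μ-outside : ∀ {a b} → ¬ (a ≤ b) → μ a b ≡ 0ℤ
      μ-refl    : ∀ a → μ a a ≡ 1ℤ
      μ-rec     : ∀ {a b} → a < b →
                  μ a b ≡ ℤ.- sumℤ (map (μ a) (filter (λ c → (a ≤? c) ×-dec (c <? b)) elements))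

record FiniteLattice : Set₁ where
  infix  4 _≤_ _≤?_
  infixr 6 _∨_
  infixr 7 _∧_
  field
    Carrier   : Set
    finite    : Finite Carrier
    _≤_       : Rel Carrier 0ℓ
    _≤?_      : Decidable _≤_
    _∨_ _∧_   : Carrier → Carrier → Carrier
    ⊥         : Carrier
    isLattice : IsLattice _≡_ _≤_ _∨_ _∧_
    minimum   : Minimum _≤_ ⊥

  open Finite finite public
  open FiniteOrder finite _≤?_ public

module CoreLabels (L : FiniteLattice) where
  open FiniteLattice L

  -- IsLabel a b c says c = λ(a,b).  It is a relation because the minimum need
  -- not exist in a lattice that is not semidistributive.
  IsLabel : Carrier → Carrier → Carrier → Set
  IsLabel a b c = a ∨ c ≡ b × (∀ d → a ∨ d ≡ b → c ≤ d)

  isLabel? : ∀ a b c → Dec (IsLabel a b c)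
  isLabel? a b c = (a ∨ c ≟ b) ×-dec all? (λ d → (a ∨ d ≟ b) →-dec (c ≤? d))

  Cov↓ : Carrier → List Carrier
  Cov↓ a = filter (_⋖? a) elements

  Can : Carrier → Pred Carrier 0ℓ
  Can a c = ∃[ b ] (b ⋖ a × IsLabel b a c)

  Can? : ∀ a → Unary.Decidable (Can a)
  Can? a c = any? (λ b → (b ⋖? a) ×-dec isLabel? b a c)

  nucleus : Carrier → Carrier
  nucleus a = foldr _∧_ a (Cov↓ a)

  Ψ : Carrier → Pred Carrier 0ℓ
  Ψ a c = ∃[ b ] ∃[ b′ ] (nucleus a ≤ b × b ⋖ b′ × b′ ≤ a × IsLabel b b′ c)

  Ψ? : ∀ a → Unary.Decidable (Ψ a)
  Ψ? a c = any? λ b → any? λ b′ →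
    (nucleus a ≤? b) ×-dec (b ⋖? b′) ×-dec (b′ ≤? a) ×-dec isLabel? b b′ c

  infix 4 _⊑_ _⊑?_

  _⊑_ : Rel Carrier 0ℓ
  a ⊑ b = Ψ a ⊆ Ψ b

  _⊑?_ : Decidable _⊑_
  a ⊑? b = map′ (λ f {c} → f c) (λ f c → f {c}) (all? (λ c → Ψ? a c →-dec Ψ? b c))

  module CLO = FiniteOrder finite _⊑?_

  Atom : Pred Carrier 0ℓ
  Atom c = ⊥ ⋖ c

  Atom? : Unary.Decidable Atom
  Atom? = ⊥ ⋖?_

  neg : Carrier → ℕ
  neg u = length (filter (λ c → Can? u c ×-dec Atom? c) elements)

  AtomLabel : Carrier → Carrier → Set
  AtomLabel a b = ∃[ c ] (IsLabel a b c × Atom c)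

  atomLabel? : Decidable AtomLabel
  atomLabel? a b = any? (λ c → isLabel? a b c ×-dec Atom? c)

  -- For A ⊆ Cov↓ u the subtrahend counts distinct elements of Can u that are
  -- atoms, so the truncated subtraction is exact.
  neg~ : Carrier → List Carrier → ℕ
  neg~ u A = neg u ∸ length (filter (λ u′ → atomLabel? u′ u) A)

record IsTriword {n : ℕ} (w : Vec (Fin 3) n) : Set where
  constructor mkIsTriword
  field
    T2 : ∀ i → toℕ i ≡ 0 → lookup w i ≢ 2F
    T3 : ∀ i j → i Fin.< j → lookup w i ≡ 0F → lookup w j ≢ 1F

isTriword? : ∀ {n} (w : Vec (Fin 3) n) → Dec (IsTriword w)
isTriword? w = map′ (λ { (t2 , t3) → mkIsTriword t2 t3 })
                    (λ { (mkIsTriword t2 t3) → t2 , t3 })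
  (Fin.all? (λ i → (toℕ i ℕ.≟ 0) →-dec ¬? (lookup w i Fin.≟ 2F)) ×-dec
   Fin.all? (λ i → Fin.all? λ j →
     (i Fin.<? j) →-dec (lookup w i Fin.≟ 0F) →-dec ¬? (lookup w j Fin.≟ 1F)))

-- isTriword is an irrelevant field, so triwords are equal as soon as their words are.
record Tri (n : ℕ) : Set where
  constructor tri
  field
    word       : Vec (Fin 3) n
    .isTriword : IsTriword word

open Tri public using (word)

triword : ∀ {n} (u : Tri n) → IsTriword (word u)
triword (tri w p) = recompute (isTriword? w) p

word-injective : ∀ {n} {u v : Tri n} → word u ≡ word v → u ≡ v
word-injective {u = tri _ _} {tri _ _} refl = refl

letter : ∀ {n} → Tri n → Fin n → Fin 3
letter u = lookup (word u)

letter-injective : ∀ {n} {u v : Tri n} → (∀ i → letter u i ≡ letter v i) → u ≡ v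
letter-injective {u = u} {v} eq = word-injective
  (trans (sym (Vec.tabulate∘lookup (word u)))
         (trans (Vec.tabulate-cong eq) (Vec.tabulate∘lookup (word v))))

words : ∀ n → List (Vec (Fin 3) n)
words zero    = [] ∷ []
words (suc n) = cartesianProductWith _∷_ (allFin 3) (words n)

words-complete : ∀ {n} (w : Vec (Fin 3) n) → w ∈ words n
words-complete []      = Any.here refl
words-complete (x ∷ w) = ∈-cartesianProductWith⁺ _∷_ (∈-allFin x) (words-complete w)

words-unique : ∀ n → Unique (words n)
words-unique zero    = All.[] ∷ []
words-unique (suc n) = Unique.cartesianProductWith⁺ _∷_
  (λ { refl → refl , refl }) (Unique.allFin⁺ 3) (words-unique n)

toTri : ∀ {n} → Vec (Fin 3) n → Maybe (Tri n)
toTri w with isTriword? w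
... | yes p = just (tri w p)
... | no  _ = nothing

toTri-word : ∀ {n} (u : Tri n) → MAny.Any (u ≡_) (toTri (word u))
toTri-word u with isTriword? (word u)
... | yes _ = MAny.just refl
... | no ¬p = contradiction (triword u) ¬p

toTri-≢ : ∀ {n} (u : Tri n) {w} → word u ≢ w → MAll.All (u ≢_) (toTri w)
toTri-≢ u {w} u≢w with isTriword? w
... | yes _ = MAll.just (u≢w ∘ cong word)
... | no  _ = MAll.nothing

triwords : ∀ n → List (Tri n)
triwords n = mapMaybe toTri (words n)

triwords-complete : ∀ {n} (u : Tri n) → u ∈ triwords n
triwords-complete {n} u = Any.mapMaybe⁺ toTri (words n)
  (Any.map⁺ (Any.map (λ { refl → toTri-word u }) (words-complete (word u))))

triwords-unique : ∀ n → Unique (triwords n)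
triwords-unique n = go (words-unique n)
  where
  go : ∀ {ws} → Unique ws → Unique (mapMaybe toTri ws)
  go []                   = []
  go (_∷_ {x = w} w∉ ws!) with isTriword? w
  ... | no  _ = go ws!
  ... | yes p = All.mapMaybe⁺ (All.map⁺ (All.map (toTri-≢ (tri w p)) w∉)) ∷ go ws!

Tri-finite : ∀ n → Finite (Tri n)
Tri-finite n = record
  { elements = triwords n
  ; complete = triwords-complete
  ; unique   = triwords-unique n
  ; _≟_      = λ u v → map′ word-injective (cong word) (Vec.≡-dec Fin._≟_ (word u) (word v))
  }

private
  module ⊔ = Max (Fin.≤-totalOrder 3)
  module ⊓ = Min (Fin.≤-totalOrder 3)

infix 4 _≤ᵗ_

_≤ᵗ_ : ∀ {n} → Rel (Tri n) 0ℓ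
u ≤ᵗ v = ∀ i → letter u i Fin.≤ letter v i

_≤ᵗ?_ : ∀ {n} → Decidable (_≤ᵗ_ {n})
u ≤ᵗ? v = Fin.all? (λ i → letter u i Fin.≤? letter v i)

⊥ᵗ : ∀ {n} → Tri n
⊥ᵗ {n} = tri (replicate n 0F) (mkIsTriword
  (λ i _ eq → 0≢2 (trans (sym (Vec.lookup-replicate i 0F)) eq))
  (λ _ j _ _ eq → 0≢1 (trans (sym (Vec.lookup-replicate j 0F)) eq)))
  where
  0≢1 : _≢_ {A = Fin 3} 0F 1F
  0≢1 ()
  0≢2 : _≢_ {A = Fin 3} 0F 2F
  0≢2 ()

maxWord : ∀ {n} → Tri n → Tri n → Vec (Fin 3) n
maxWord u v = tabulate (λ i → letter u i ⊔.⊔ letter v i)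

lookup-maxWord : ∀ {n} (u v : Tri n) i → lookup (maxWord u v) i ≡ letter u i ⊔.⊔ letter v i
lookup-maxWord u v = Vec.lookup∘tabulate _

maxWord-isTriword : ∀ {n} (u v : Tri n) → IsTriword (maxWord u v)
maxWord-isTriword u v = mkIsTriword t2 t3
  where
  module U = IsTriword (triword u)
  module V = IsTriword (triword v)

  zeros : ∀ (x y : Fin 3) → x ⊔.⊔ y ≡ 0F → x ≡ 0F × y ≡ 0F
  zeros 0F 0F _ = refl , refl
  zeros 0F 1F ()
  zeros 0F 2F ()
  zeros 1F 0F ()
  zeros 1F 1F ()
  zeros 1F 2F ()
  zeros 2F 0F ()
  zeros 2F 1F ()
  zeros 2F 2F ()

  t2 : ∀ i → toℕ i ≡ 0 → lookup (maxWord u v) i ≢ 2F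
  t2 i i≡0 eq with ⊔.⊔-sel (letter u i) (letter v i) | trans (sym (lookup-maxWord u v i)) eq
  ... | inj₁ s | e = U.T2 i i≡0 (trans (sym s) e)
  ... | inj₂ s | e = V.T2 i i≡0 (trans (sym s) e)

  t3 : ∀ i j → i Fin.< j → lookup (maxWord u v) i ≡ 0F → lookup (maxWord u v) j ≢ 1F
  t3 i j i<j eq0 eq1
    with ⊔.⊔-sel (letter u j) (letter v j) | trans (sym (lookup-maxWord u v j)) eq1
       | zeros _ _ (trans (sym (lookup-maxWord u v i)) eq0)
  ... | inj₁ s | e | u0 , _ = U.T3 i j i<j u0 (trans (sym s) e)
  ... | inj₂ s | e | _ , v0 = V.T3 i j i<j v0 (trans (sym s) e)

infixr 6 _∨ᵗ_
infixr 7 _∧ᵗ_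

_∨ᵗ_ : ∀ {n} → Tri n → Tri n → Tri n
u ∨ᵗ v = tri (maxWord u v) (maxWord-isTriword u v)

minLetter : ∀ {n} → Tri n → Tri n → Fin n → Fin 3
minLetter u v i = letter u i ⊓.⊓ letter v i

Replaced : ∀ {n} → Tri n → Tri n → Fin n → Set
Replaced u v i = minLetter u v i ≡ 1F × ∃[ k ] (k Fin.< i × minLetter u v k ≡ 0F)

replaced? : ∀ {n} (u v : Tri n) i → Dec (Replaced u v i)
replaced? u v i = (minLetter u v i Fin.≟ 1F) ×-dec
                  Fin.any? (λ k → (k Fin.<? i) ×-dec (minLetter u v k Fin.≟ 0F))

meetLetter : ∀ {n} → Tri n → Tri n → Fin n → Fin 3
meetLetter u v i with replaced? u v i
... | yes _ = 0F
... | no  _ = minLetter u v i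

meetWord : ∀ {n} → Tri n → Tri n → Vec (Fin 3) n
meetWord u v = tabulate (meetLetter u v)

lookup-meetWord : ∀ {n} (u v : Tri n) i → lookup (meetWord u v) i ≡ meetLetter u v i
lookup-meetWord u v = Vec.lookup∘tabulate _

meetLetter≤min : ∀ {n} (u v : Tri n) i → meetLetter u v i Fin.≤ minLetter u v i
meetLetter≤min u v i with replaced? u v i
... | yes _ = z≤n
... | no  _ = Fin.≤-refl

meetWord-isTriword : ∀ {n} (u v : Tri n) → IsTriword (meetWord u v)
meetWord-isTriword u v = mkIsTriword
  (λ i i≡0 eq → t2 i i≡0 (trans (sym (lookup-meetWord u v i)) eq))
  (λ i j i<j eq0 eq1 → t3 i j i<j (trans (sym (lookup-meetWord u v i)) eq0)
                                  (trans (sym (lookup-meetWord u v j)) eq1))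
  where
  module U = IsTriword (triword u)
  module V = IsTriword (triword v)

  t2 : ∀ i → toℕ i ≡ 0 → meetLetter u v i ≢ 2F
  t2 i i≡0 eq with replaced? u v i
  t2 i i≡0 () | yes _
  ... | no _ with ⊓.⊓-sel (letter u i) (letter v i)
  ... | inj₁ s = U.T2 i i≡0 (trans (sym s) eq)
  ... | inj₂ s = V.T2 i i≡0 (trans (sym s) eq)

  t3 : ∀ i j → i Fin.< j → meetLetter u v i ≡ 0F → meetLetter u v j ≢ 1F
  t3 i j i<j eq0 eq1 with replaced? u v j
  t3 i j i<j eq0 () | yes _
  ... | no ¬r with replaced? u v i
  ... | yes (_ , k , k<i , mk0) = ¬r (eq1 , k , Fin.<-trans k<i i<j , mk0)
  ... | no _                    = ¬r (eq1 , i , i<j , eq0)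

_∧ᵗ_ : ∀ {n} → Tri n → Tri n → Tri n
u ∧ᵗ v = tri (meetWord u v) (meetWord-isTriword u v)

≤ᵗ-isLattice : ∀ n → IsLattice (_≡_ {A = Tri n}) _≤ᵗ_ _∨ᵗ_ _∧ᵗ_
≤ᵗ-isLattice n = record
  { isPartialOrder = record
    { isPreorder = record
      { isEquivalence = isEquivalence
      ; reflexive     = λ { refl i → Fin.≤-refl }
      ; trans         = λ u≤v v≤w i → Fin.≤-trans (u≤v i) (v≤w i)
      }
    ; antisym = λ u≤v v≤u → letter-injective (λ i → Fin.≤-antisym (u≤v i) (v≤u i))
    }
  ; supremum = λ u v →
      (λ i → subst (letter u i Fin.≤_) (sym (lookup-maxWord u v i))
                   (⊔.x≤x⊔y (letter u i) (letter v i)))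
    , (λ i → subst (letter v i Fin.≤_) (sym (lookup-maxWord u v i))
                   (⊔.x≤y⊔x (letter u i) (letter v i)))
    , (λ w u≤w v≤w i → subst (Fin._≤ letter w i) (sym (lookup-maxWord u v i))
                             (⊔.⊔-lub (u≤w i) (v≤w i)))
  ; infimum = λ u v →
      (λ i → subst (Fin._≤ letter u i) (sym (lookup-meetWord u v i))
                   (Fin.≤-trans (meetLetter≤min u v i) (⊓.x⊓y≤x (letter u i) (letter v i))))
    , (λ i → subst (Fin._≤ letter v i) (sym (lookup-meetWord u v i))
                   (Fin.≤-trans (meetLetter≤min u v i) (⊓.x⊓y≤y (letter u i) (letter v i))))
    , (λ w w≤u w≤v i → subst (letter w i Fin.≤_) (sym (lookup-meetWord u v i))
                             (greatest u v w w≤u w≤v i))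
  }
  where
  ≤0 : ∀ (x : Fin 3) → x Fin.≤ Fin.zero {2} → x ≡ 0F
  ≤0 0F _ = refl

  ≤1 : ∀ (x : Fin 3) → x Fin.≤ Fin.suc (Fin.zero {1}) → x ≢ 1F → x Fin.≤ Fin.zero {2}
  ≤1 0F _ _ = z≤n
  ≤1 1F _ x≢1 = contradiction refl x≢1
  ≤1 2F (s≤s ()) _

  greatest : ∀ (u v w : Tri n) → w ≤ᵗ u → w ≤ᵗ v → ∀ i → letter w i Fin.≤ meetLetter u v i
  greatest u v w w≤u w≤v i with replaced? u v i
  ... | no  _ = ⊓.⊓-glb (w≤u i) (w≤v i)
  ... | yes (mi1 , k , k<i , mk0) = ≤1 (letter w i)
    (subst (letter w i Fin.≤_) mi1 (⊓.⊓-glb (w≤u i) (w≤v i)))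
    (IsTriword.T3 (triword w) k i k<i
      (≤0 (letter w k) (subst (letter w k Fin.≤_) mk0 (⊓.⊓-glb (w≤u k) (w≤v k)))))

Hoch : ℕ → FiniteLattice
Hoch n = record
  { Carrier   = Tri n
  ; finite    = Tri-finite n
  ; _≤_       = _≤ᵗ_
  ; _≤?_      = _≤ᵗ?_
  ; _∨_       = _∨ᵗ_
  ; _∧_       = _∧ᵗ_
  ; ⊥         = ⊥ᵗ
  ; isLattice = ≤ᵗ-isLattice n
  ; minimum   = λ u i → subst (Fin._≤ letter u i) (sym (Vec.lookup-replicate i 0F)) z≤n
  }

module Hochschild (n : ℕ) = CoreLabels (Hoch n)

IsRank : ∀ n → (Tri n → ℕ) → Set
IsRank n = Hochschild.CLO.IsRankFunction n ⊥ᵗ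

IsMöbius : ∀ n → (Tri n → Tri n → ℤ) → Set
IsMöbius n = Hochschild.CLO.IsMöbiusFunction n

module Triangles {c ℓ} (R : CommutativeRing c ℓ) where
  open CommutativeRing R renaming (Carrier to K)
  open RawMonoid +-rawMonoid using () renaming (_×_ to _×ᴷ_)
  open Exp semiring public using (_^_)

  ∑ : {A : Set} → List A → (A → K) → K
  ∑ xs f = foldr _+_ 0# (map f xs)

  fromℤ : ℤ → K
  fromℤ (ℤ.+ m)    = m ×ᴷ 1#
  fromℤ ℤ.-[1+ m ] = - (suc m ×ᴷ 1#)

  M-triangle : ∀ n → (Tri n → ℕ) → (Tri n → Tri n → ℤ) → K → K → K
  M-triangle n rk μ x y =
    ∑ (triwords n) λ u → ∑ (triwords n) λ v → fromℤ (μ u v) * x ^ rk u * y ^ rk v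

  -- y⁻¹ and d⁻¹ stand for the inverses of y and y - x.  Rational functions in
  -- x and y whose denominators are products of powers of y and y - x agree iff
  -- they agree at all x, y in all commutative rings in which y and y - x are
  -- invertible: ℤ[x, y] localised at y (y - x) is one such ring.
  F-triangle : ∀ n → (Tri n → ℕ) → (Tri n → Tri n → ℤ) → (x y y⁻¹ d⁻¹ : K) → K
  F-triangle n rk μ x y y⁻¹ d⁻¹ =
    y ^ n * M-triangle n rk μ ((y + 1#) * d⁻¹) ((y - x) * y⁻¹)

{-# OPTIONS --safe #-}

-- Encode a triword u of length n = 1 + m by the set S of positions of its 2s and by the position l
-- of its last 1 (if any), and write t_l for 1…10…0 with l ones.  The core label set Ψ u consists of
-- the atoms at the positions in S and of the t_l at which u splits into a part without 0 followed
-- by a part without 1.  Hence u ⊑ v iff every 2 of u is a 2 of v and, when u₁ = 1, vᵢ ∈ {uᵢ, 2} for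
-- all i; the rank of u is |S| + [u₁ = 1].
--
-- No explicit Möbius function is needed: f u = ∑ᵥ μ(u,v) Y^rk(v) is the only solution of
-- ∑_{v ⊒ u} f v = Y^rk(u).  With s = |S|, e = m - s and Z = 1 - Y it is Y^(s+1) Z^e if u₁ = 1 and
-- Y^s Z^e (1 - (1+e) Y) if u₁ = 0, because each S occurs for 1 + e triwords with u₁ = 1.
-- So y^n M_n = ∑ᵤ y^n X^rk(u) f u, and this agrees with the right-hand side already after summing
-- over the triwords with a given S: the sum over A ⊆ Cov↓ u is a power of x times one factor 1 + y
-- per atom in Can u and one factor 1 + x for the remaining cover, if there is one.
module Submission where

open import Defs
open import Algebra.Bundles using (CommutativeRing)
open import Data.Nat.Base as ℕ using (ℕ; zero; suc; _>_; _∸_; z≤n; s≤s)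
open import Data.Integer.Base as ℤ using (ℤ)
open import Data.List.Base using (List; []; _∷_; _++_; filter; foldr; length; map; mapMaybe)
open import Data.Bool.Base using (Bool; true; false; if_then_else_)
open import Data.Fin.Base as Fin using (Fin; zero; suc; toℕ)
open import Data.Fin.Patterns using (0F; 1F; 2F)
import Data.Fin.Properties as Fin
open import Data.Fin.Subset using (Subset; ∣_∣; ∁; inside; outside; _⊆_)
open import Data.Fin.Subset.Properties as Subset using (_⊆?_)
import Data.Integer.Properties as ℤ
import Data.List.Properties as List
open import Data.List.Membership.Propositional using (_∈_)
open import Data.List.Membership.Propositional.Properties
  using (∈-++⁻; ∈-filter⁺; ∈-filter⁻; ∈-map⁺; ∈-map⁻)
open import Data.List.Membership.Propositional.Properties.WithK using (unique∧set⇒bag)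
open import Data.List.Relation.Binary.BagAndSetEquality using (∼bag⇒↭)
open import Data.List.Relation.Binary.Permutation.Propositional.Properties using (↭-length)
import Data.List.Relation.Unary.All as All
import Data.List.Relation.Unary.All.Properties as All
open import Data.List.Relation.Unary.AllPairs using ([]; _∷_)
open import Data.List.Relation.Unary.Any using (here; there)
open import Data.List.Relation.Unary.Unique.Propositional using (Unique)
import Data.List.Relation.Unary.Unique.Propositional.Properties as Unique
open import Data.Maybe.Base using (Maybe; just; nothing; maybe)
import Data.Nat.Properties as ℕ
open import Data.Product using (_×_; _,_; proj₁; proj₂; ∃; ∃-syntax)
open import Data.Sum using (_⊎_; inj₁; inj₂; [_,_]′)
open import Data.Vec.Base as Vec using (Vec; []; _∷_; here; there; lookup; tabulate; _[_]≔_)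
import Data.Vec.Properties as Vec
open import Function using (_∘_; case_of_; mk⇔)
open import Level using (0ℓ)
open import Relation.Binary using (Rel; Decidable; Reflexive; Transitive; tri<; tri≈; tri>)
open import Relation.Binary.Lattice.Structures using (IsLattice)
import Relation.Binary.PropositionalEquality as ≡
open ≡ using (_≡_; _≢_)
import Relation.Binary.Reasoning.Setoid
open import Relation.Nullary using (¬_; Dec; yes; no; contradiction; does)
open import Relation.Nullary.Decidable
  using (¬?; _×-dec_; _⊎-dec_; _→-dec_; does-⇔; dec-true; dec-false)
import Relation.Unary as Unary
import Algebra.Construct.NaturalChoice.Max as Max
import Algebra.Properties.CommutativeMonoid.Mult
import Algebra.Properties.CommutativeSemigroup
import Algebra.Properties.CommutativeSemiring.Exp
import Algebra.Properties.Ring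
import Algebra.Properties.Semiring.Exp
import Algebra.Properties.Semiring.Mult
import Algebra.Solver.Ring.NaturalCoefficients.Default

-- Covers, labels and the core label order

-- A lower cover in Hoch(n) decreases one 2 or the last 1, and its label depends only on the
-- position: the atom there, or, for a last 1, the word with 1s exactly up to there. If `b ⋖ b′` in
-- the core of u decreases a 1 at position l, then u has no 0 up to l because `b′` is below u, and
-- no 1 after l because `b` is above the nucleus; hence the splits.
--
-- The formula for f comes from two Boolean inversions. Above a u with u₁ = 1 lie the words obtained
-- by turning letters into 2s, a Boolean lattice of dimension e, which gives Y^(s+1) Z^e. Above a u
-- with u₁ = 0 lie all triwords whose 2s include S, so inversion over sets prescribes Y^s Z^e as the
-- total of f over the triwords whose 2s are exactly S; what those with u₁ = 1 leave of it is the
-- value at u₁ = 0.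
--
-- For fixed S both sides equal (1+y)^s x^e times y + (1+e)(1+x). On the right-hand side this factor
-- is x from the triword without 1s, 1+y from the one whose only 1 is its first letter, and 1+x from
-- each of the e others.

module Order where
  open ≡ using (refl; sym; trans; cong; subst)

  ≤0⇒≡0 : {a : Fin 3} → a Fin.≤ Fin.zero {2} → a ≡ 0F
  ≤0⇒≡0 {0F} _ = refl

  ≡0⊎≡1⊎≡2 : (a : Fin 3) → a ≡ 0F ⊎ a ≡ 1F ⊎ a ≡ 2F
  ≡0⊎≡1⊎≡2 0F = inj₁ refl
  ≡0⊎≡1⊎≡2 1F = inj₂ (inj₁ refl)
  ≡0⊎≡1⊎≡2 2F = inj₂ (inj₂ refl)

  ≢0∧≢2⇒≡1 : {a : Fin 3} → a ≢ 0F → a ≢ 2F → a ≡ 1F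
  ≢0∧≢2⇒≡1 {0F} p q = contradiction refl p
  ≢0∧≢2⇒≡1 {1F} p q = refl
  ≢0∧≢2⇒≡1 {2F} p q = contradiction refl q

  ≢1∧≢2⇒≡0 : {a : Fin 3} → a ≢ 1F → a ≢ 2F → a ≡ 0F
  ≢1∧≢2⇒≡0 {0F} p q = refl
  ≢1∧≢2⇒≡0 {1F} p q = contradiction refl p
  ≢1∧≢2⇒≡0 {2F} p q = contradiction refl q

  2≤⇒≡2 : {a : Fin 3} → Fin.suc (Fin.suc (Fin.zero {0})) Fin.≤ a → a ≡ 2F
  2≤⇒≡2 {1F} (s≤s ())
  2≤⇒≡2 {2F} _ = refl

  ≢0⇒1≤ : {a : Fin 3} → a ≢ 0F → Fin.suc (Fin.zero {1}) Fin.≤ a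
  ≢0⇒1≤ {0F} p = contradiction refl p
  ≢0⇒1≤ {suc a} p = s≤s z≤n

  ≤2 : {a : Fin 3} → a Fin.≤ Fin.suc (Fin.suc (Fin.zero {0}))
  ≤2 {0F} = z≤n
  ≤2 {1F} = s≤s z≤n
  ≤2 {2F} = s≤s (s≤s z≤n)

  LastOne : ∀ {n} → Vec (Fin 3) n → Fin n → Set
  LastOne w k = lookup w k ≡ 1F × (∀ j → k Fin.< j → lookup w j ≢ 1F)

  NoOnes : ∀ {n} → Vec (Fin 3) n → Set
  NoOnes w = ∀ j → lookup w j ≢ 1F

  noOnes⊎lastOne : ∀ {n} (w : Vec (Fin 3) n) → NoOnes w ⊎ ∃ (LastOne w)
  noOnes⊎lastOne []      = inj₁ λ ()
  noOnes⊎lastOne (a ∷ w) with noOnes⊎lastOne w | a Fin.≟ 1F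
  ... | inj₂ (k , k≡1 , last) | _ = inj₂ (suc k , k≡1 , λ { (suc j) (s≤s k<j) → last j k<j })
  ... | inj₁ none | yes a≡1 = inj₂ (zero , a≡1 , λ { (suc j) _ → none j })
  ... | inj₁ none | no  a≢1 = inj₁ λ { zero → a≢1 ; (suc j) → none j }

  module _ {n : ℕ} where
    open FiniteLattice (Hoch n) using (_<_; _⋖_; _≟_; isLattice)
    open IsLattice isLattice public
      using (antisym; supremum)

    T3 : (u : Tri n) → ∀ {i j} → i Fin.< j → letter u i ≡ 0F → letter u j ≢ 1F
    T3 u = IsTriword.T3 (triword u) _ _

    T2 : (u : Tri n) → ∀ {i} → toℕ i ≡ 0 → letter u i ≢ 2F
    T2 u = IsTriword.T2 (triword u) _

    ≡⇒≤ᵗ : ∀ {u v : Tri n} {i} → letter u i ≡ letter v i → letter u i Fin.≤ letter v i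
    ≡⇒≤ᵗ {u} {v} {i} eq = subst (letter u i Fin.≤_) eq Fin.≤-refl

    replace-isTriword : (u : Tri n) (i : Fin n) (a : Fin 3) →
      (toℕ i ≡ 0 → a ≢ 2F) →
      (a ≡ 0F → ∀ j → i Fin.< j → letter u j ≢ 1F) →
      (a ≡ 1F → ∀ j → j Fin.< i → letter u j ≢ 0F) →
      IsTriword (word u [ i ]≔ a)
    replace-isTriword u i a no2 no1 no0 = mkIsTriword t2 t3
      where
      at-i : lookup (word u [ i ]≔ a) i ≡ a
      at-i = Vec.lookup∘update i (word u) a
      off-i : ∀ {j} → j ≢ i → lookup (word u [ i ]≔ a) j ≡ letter u j
      off-i j≢i = Vec.lookup∘update′ j≢i (word u) a

      t2 : ∀ j → toℕ j ≡ 0 → lookup (word u [ i ]≔ a) j ≢ 2F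
      t2 j j≡0 eq with j Fin.≟ i
      ... | yes refl = no2 j≡0 (trans (sym at-i) eq)
      ... | no j≢i   = T2 u j≡0 (trans (sym (off-i j≢i)) eq)

      t3 : ∀ j k → j Fin.< k → lookup (word u [ i ]≔ a) j ≡ 0F → lookup (word u [ i ]≔ a) k ≢ 1F
      t3 j k j<k eq0 eq1 with j Fin.≟ i | k Fin.≟ i
      ... | yes refl | yes refl = Fin.<-irrefl refl j<k
      ... | yes refl | no k≢i   = no1 (trans (sym at-i) eq0) k j<k (trans (sym (off-i k≢i)) eq1)
      ... | no j≢i   | yes refl = no0 (trans (sym at-i) eq1) j j<k (trans (sym (off-i j≢i)) eq0)
      ... | no j≢i   | no k≢i   =
        T3 u j<k (trans (sym (off-i j≢i)) eq0) (trans (sym (off-i k≢i)) eq1)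

    -- The positions whose entry can be decreased without changing any other entry.
    Removable : Tri n → Fin n → Set
    Removable u i = letter u i ≡ 2F ⊎ LastOne (word u) i

    abstract
      -- The fallback value u is not taken at removable positions: see lower-spec.
      lower : Tri n → Fin n → Tri n
      lower u i with isTriword? (word u [ i ]≔ Fin.pred (letter u i)) | isTriword? (word u [ i ]≔ 0F)
      ... | yes p | _     = tri _ p
      ... | no _  | yes p = tri _ p
      ... | no _  | no _  = u

      -- The last 1 can always become 0. A 2 becomes 1 unless a 0 stands before it; in that case
      -- every `b ≤ᵗ u` has this 0 as well, so (T3) forbids a 1 at `i` in `b`. Hence the new letter
      -- is the largest one possible, which is what makes `lower u i` a cover.
      lower-spec : ∀ {u i} → Removable u i → ∃[ a ]
        (word (lower u i) ≡ word u [ i ]≔ a × a Fin.< letter u i ×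
         (∀ b → b ≤ᵗ u → letter b i Fin.< letter u i → letter b i Fin.≤ a))
      lower-spec {u} {i} r
        with isTriword? (word u [ i ]≔ Fin.pred (letter u i)) | isTriword? (word u [ i ]≔ 0F)
      ... | yes p | _ = _ , refl , pred< r , λ b _ → below (letter b i) (letter u i)
        where
        pred< : Removable u i → Fin.pred (letter u i) Fin.< letter u i
        pred< (inj₁ eq)       rewrite eq = s≤s (s≤s z≤n)
        pred< (inj₂ (eq , _)) rewrite eq = s≤s z≤n
        below : (a b : Fin 3) → a Fin.< b → a Fin.≤ Fin.pred b
        below 0F _ _ = z≤n
        below 1F 2F _ = s≤s z≤n
        below 1F 1F (s≤s ())
        below 2F 1F (s≤s ())
        below 2F 2F (s≤s (s≤s ()))
      lower-spec {u} {i} (inj₂ (eq , last)) | no ¬p | _ = contradiction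
        (subst (λ a → IsTriword (word u [ i ]≔ Fin.pred a)) (sym eq)
          (replace-isTriword u i 0F (λ _ ()) (λ _ → last) (λ ()))) ¬p
      -- Replacing a 2 by 0 fails only if a 1 follows; then no 0 precedes, and replacing it by 1
      -- succeeds.
      lower-spec {u} {i} (inj₁ eq) | no ¬p | no ¬q = contradiction
        (replace-isTriword u i 0F (λ _ ())
          (λ _ j i<j u≡1 → ¬p (subst (λ a → IsTriword (word u [ i ]≔ Fin.pred a)) (sym eq)
            (replace-isTriword u i 1F (λ _ ()) (λ ())
              λ _ k k<i u≡0 → T3 u (Fin.<-trans k<i i<j) u≡0 u≡1)))
          (λ ())) ¬q
      lower-spec {u} {i} (inj₁ eq) | no ¬p | yes q =
        0F , refl , subst (Fin.zero {2} Fin.<_) (sym eq) (s≤s z≤n) ,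
        λ b b≤u b<u → below b b≤u (subst (letter b i Fin.<_) eq b<u)
        where
        below : ∀ b → b ≤ᵗ u → letter b i Fin.< Fin.suc (Fin.suc (Fin.zero {0})) →
                letter b i Fin.≤ Fin.zero {2}
        below b b≤u b<2 with letter b i in b-eq
        ... | 0F = z≤n
        ... | 1F = contradiction
          (subst (λ a → IsTriword (word u [ i ]≔ Fin.pred a)) (sym eq)
            (replace-isTriword u i 1F (λ _ ()) (λ ()) λ _ j j<i u≡0 →
              T3 b j<i (≤0⇒≡0 (subst (letter b j Fin.≤_) u≡0 (b≤u j))) b-eq)) ¬p
        below b b≤u (s≤s (s≤s ())) | 2F

    lower-off : ∀ {u i j} → Removable u i → j ≢ i → letter (lower u i) j ≡ letter u j
    lower-off {u} {i} {j} r j≢i with a , eq , _ ← lower-spec {u} {i} r =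
      trans (cong (λ w → lookup w j) eq) (Vec.lookup∘update′ j≢i (word u) a)

    lower-at : ∀ {u i} → Removable u i → letter (lower u i) i Fin.< letter u i
    lower-at {u} {i} r with a , eq , a< , _ ← lower-spec {u} {i} r =
      subst (Fin._< letter u i)
        (sym (trans (cong (λ w → lookup w i) eq) (Vec.lookup∘update i (word u) a))) a<

    lower≤ : ∀ {u i} → Removable u i → lower u i ≤ᵗ u
    lower≤ {u} {i} r j with j Fin.≟ i
    ... | yes refl = ℕ.<⇒≤ (lower-at {u} r)
    ... | no j≢i   = ≡⇒≤ᵗ {lower u i} {u} {j} (lower-off {u} r j≢i)

    ≤lower : ∀ {u i b} → Removable u i → b ≤ᵗ u → letter b i Fin.< letter u i → b ≤ᵗ lower u i
    ≤lower {u} {i} {b} r b≤u b< j with j Fin.≟ i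
    ... | no j≢i   = subst (letter b j Fin.≤_) (sym (lower-off {u} r j≢i)) (b≤u j)
    ... | yes refl with a , eq , _ , max ← lower-spec {u} {i} r =
      subst (letter b i Fin.≤_)
        (sym (trans (cong (λ w → lookup w i) eq) (Vec.lookup∘update i (word u) a))) (max b b≤u b<)

    lower-⋖ : ∀ {u i} → Removable u i → lower u i ⋖ u
    lower-⋖ {u} {i} r =
      (lower≤ {u} r , λ eq → Fin.<-irrefl (cong (λ v → letter v i) eq) (lower-at {u} r)) , between
      where
      between : ∀ z → ¬ (lower u i < z × z < u)
      between z ((l≤z , l≢z) , (z≤u , z≢u)) =
        l≢z (antisym l≤z (≤lower {u} {b = z} r z≤u
          (Fin.≤∧≢⇒< (z≤u i) λ eq → z≢u (letter-injective (agree eq)))))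
        where
        agree : letter z i ≡ letter u i → ∀ j → letter z j ≡ letter u j
        agree eq j with j Fin.≟ i
        ... | yes refl = eq
        ... | no j≢i   = Fin.≤-antisym (z≤u j) (subst (Fin._≤ letter z j) (lower-off {u} r j≢i) (l≤z j))

    -- It suffices that any `w` strictly below `u` lies below some `lower u k`. If `w` turns a 1 of
    -- `u` at `i` into 0, then by (T3) `w` has no 1 after `i`, so the last 1 of `u` has decreased
    -- too and its position serves as `k`.
    ⋖⇒lower : ∀ {w u} → w ⋖ u → ∃[ i ] (Removable u i × w ≡ lower u i)
    ⋖⇒lower {w} {u} ((w≤u , w≢u) , cover) =
      let i , w< = Fin.¬∀⟶∃¬ n _ (λ j → letter w j Fin.≟ letter u j) (w≢u ∘ letter-injective)
          k , r , w<′ = removable i (Fin.≤∧≢⇒< (w≤u i) w<)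
      in k , r , is-lower r (≤lower {u} {k} {w} r w≤u w<′)
      where
      is-lower : ∀ {i} → Removable u i → w ≤ᵗ lower u i → w ≡ lower u i
      is-lower {i} r w≤l with w ≟ lower u i
      ... | yes eq = eq
      ... | no neq = contradiction ((w≤l , neq) , proj₁ (lower-⋖ {u} r)) (cover (lower u i))

      removable : ∀ i → letter w i Fin.< letter u i → ∃[ k ] (Removable u k × letter w k Fin.< letter u k)
      removable i w< with letter u i in u≡
      ... | 2F = i , inj₁ u≡ , subst (letter w i Fin.<_) (sym u≡) w<
      ... | 1F with noOnes⊎lastOne (word u)
      ...   | inj₁ none = contradiction u≡ (none i)
      ...   | inj₂ (k , k≡1 , last) = k , inj₂ (k≡1 , last) , subst (letter w k Fin.<_) (sym k≡1) w<1
        where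
        w-i≡0 : letter w i ≡ 0F
        w-i≡0 = ≤0⇒≡0 (ℕ.≤-pred w<)
        w<1 : letter w k Fin.< Fin.suc (Fin.zero {1})
        w<1 with Fin.<-cmp i k
        ... | tri≈ _ refl _ = w<
        ... | tri> _ _ k<i = contradiction u≡ (last i k<i)
        ... | tri< i<k _ _ =
          Fin.≤∧≢⇒< (subst (letter w k Fin.≤_) k≡1 (w≤u k)) (T3 w i<k w-i≡0)

  -- Nuclei and uniqueness of labels in a finite lattice

  module Nucleus (L : FiniteLattice) where
    open FiniteLattice L
    open CoreLabels L
    private module L = IsLattice isLattice

    private
      foldr-∧≤⊤ : ∀ a bs → foldr _∧_ a bs ≤ a
      foldr-∧≤⊤ a []       = L.refl
      foldr-∧≤⊤ a (b ∷ bs) = L.trans (proj₁ (proj₂ (L.infimum b _))) (foldr-∧≤⊤ a bs)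

      foldr-∧≤∈ : ∀ a {b bs} → b ∈ bs → foldr _∧_ a bs ≤ b
      foldr-∧≤∈ a (here refl)             = proj₁ (L.infimum _ _)
      foldr-∧≤∈ a (there {x = b} b∈) = L.trans (proj₁ (proj₂ (L.infimum b _))) (foldr-∧≤∈ a b∈)

      ≤foldr-∧ : ∀ {a c} bs → c ≤ a → (∀ {b} → b ∈ bs → c ≤ b) → c ≤ foldr _∧_ a bs
      ≤foldr-∧ []       c≤a c≤bs = c≤a
      ≤foldr-∧ (b ∷ bs) c≤a c≤bs =
        proj₂ (proj₂ (L.infimum b _)) _ (c≤bs (here refl)) (≤foldr-∧ bs c≤a (c≤bs ∘ there))

    ∈Cov↓ : ∀ {a b} → b ⋖ a → b ∈ Cov↓ a
    ∈Cov↓ {a} {b} = ∈-filter⁺ (_⋖? a) (complete b)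

    nucleus≤ : ∀ a → nucleus a ≤ a
    nucleus≤ a = foldr-∧≤⊤ a (Cov↓ a)

    nucleus≤cover : ∀ {a b} → b ⋖ a → nucleus a ≤ b
    nucleus≤cover {a} b⋖a = foldr-∧≤∈ a (∈Cov↓ b⋖a)

    ≤nucleus : ∀ {a c} → c ≤ a → (∀ {b} → b ⋖ a → c ≤ b) → c ≤ nucleus a
    ≤nucleus {a} c≤a c≤ = ≤foldr-∧ (Cov↓ a) c≤a (λ b∈ → c≤ (proj₂ (∈-filter⁻ (_⋖? a) {xs = elements} b∈)))

    IsLabel-unique : ∀ {a b c d} → IsLabel a b c → IsLabel a b d → c ≡ d
    IsLabel-unique (c∨ , c≤) (d∨ , d≤) = L.antisym (c≤ _ d∨) (d≤ _ c∨)

    Can⊆Ψ : ∀ {a c} → Can a c → Ψ a c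
    Can⊆Ψ {a} (b , b⋖a , label) = b , a , nucleus≤cover b⋖a , b⋖a , L.refl , label

  -- Labels and core label sets of triwords

  private module ⊔ = Max (Fin.≤-totalOrder 3)

  ∨-letter : ∀ {n} {u v w : Tri n} → u ∨ᵗ v ≡ w → ∀ i → letter u i ≡ letter w i ⊎ letter v i ≡ letter w i
  ∨-letter {u = u} {v} refl i with ⊔.⊔-sel (letter u i) (letter v i)
  ... | inj₁ eq = inj₁ (sym (trans (lookup-maxWord u v i) eq))
  ... | inj₂ eq = inj₂ (sym (trans (lookup-maxWord u v i) eq))

  private
    oneIf : {P : Set} → Dec P → Fin 3
    oneIf (yes _) = 1F
    oneIf (no _)  = 0F

    oneIf-yes : {P : Set} (p? : Dec P) → P → oneIf p? ≡ 1F
    oneIf-yes (yes _) p = refl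
    oneIf-yes (no ¬p) p = contradiction p ¬p

    oneIf-no : {P : Set} (p? : Dec P) → ¬ P → oneIf p? ≡ 0F
    oneIf-no (yes p) ¬p = contradiction p ¬p
    oneIf-no (no _)  ¬p = refl

    oneIf≢2 : {P : Set} (p? : Dec P) → oneIf p? ≢ 2F
    oneIf≢2 (yes _) ()
    oneIf≢2 (no _)  ()

  module _ {m : ℕ} where
    open FiniteLattice (Hoch (suc m)) using (_<_; _⋖_)
    open Hochschild (suc m)
    open Nucleus (Hoch (suc m))

    letter-⊥ : ∀ i → letter (⊥ᵗ {suc m}) i ≡ 0F
    letter-⊥ i = Vec.lookup-replicate i 0F

    atomAt : Fin (suc m) → Tri (suc m)
    atomAt zero    = tri (word ⊥ᵗ [ zero ]≔ 1F)
      (replace-isTriword ⊥ᵗ zero 1F (λ _ ()) (λ ()) (λ _ _ ()))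
    atomAt (suc i) = tri (word ⊥ᵗ [ suc i ]≔ 2F)
      (replace-isTriword ⊥ᵗ (suc i) 2F (λ ()) (λ ()) (λ ()))

    letter-atomAt : ∀ i → letter (atomAt (suc i)) (suc i) ≡ 2F
    letter-atomAt i = Vec.lookup∘update (suc i) (word ⊥ᵗ) 2F

    letter-atomAt-off : ∀ {i j} → j ≢ i → letter (atomAt i) j ≡ 0F
    letter-atomAt-off {zero}  {j} j≢i = trans (Vec.lookup∘update′ j≢i (word ⊥ᵗ) 1F) (letter-⊥ j)
    letter-atomAt-off {suc i} {j} j≢i = trans (Vec.lookup∘update′ j≢i (word ⊥ᵗ) 2F) (letter-⊥ j)

    atomAt≢0 : ∀ i → letter (atomAt i) i ≢ 0F
    atomAt≢0 zero ()
    atomAt≢0 (suc i) eq with () ← trans (sym (letter-atomAt i)) eq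

    atomAt-injective : ∀ {i j} → atomAt i ≡ atomAt j → i ≡ j
    atomAt-injective {i} {j} eq with i Fin.≟ j
    ... | yes i≡j = i≡j
    ... | no  i≢j = contradiction
      (trans (cong (λ u → letter u i) eq) (letter-atomAt-off i≢j)) (atomAt≢0 i)

    atomAt-isAtom : ∀ i → Atom (atomAt i)
    atomAt-isAtom i = (⊥≤ {atomAt i} , ≢⊥) , between i
      where
      ⊥≤ : ∀ {u} → ⊥ᵗ ≤ᵗ u
      ⊥≤ {u} j = subst (Fin._≤ letter u j) (sym (letter-⊥ j)) z≤n
      ≢⊥ : ⊥ᵗ ≢ atomAt i
      ≢⊥ eq = atomAt≢0 i (trans (sym (cong (λ u → letter u i) eq)) (letter-⊥ i))

      zero-off : ∀ {z i} → z ≤ᵗ atomAt i → ∀ {j} → j ≢ i → letter z j ≡ 0F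
      zero-off {z} z≤ {j} j≢i = ≤0⇒≡0 (subst (letter z j Fin.≤_) (letter-atomAt-off j≢i) (z≤ j))

      agree : ∀ {z i} → z ≤ᵗ atomAt i → letter z i ≡ letter (atomAt i) i → z ≡ atomAt i
      agree {z} {i} z≤ eq = letter-injective λ j → case j Fin.≟ i of λ where
        (yes refl) → eq
        (no j≢i)   → trans (zero-off {z} z≤ j≢i) (sym (letter-atomAt-off j≢i))

      agree⊥ : ∀ {z i} → z ≤ᵗ atomAt i → letter z i ≡ 0F → ⊥ᵗ ≡ z
      agree⊥ {z} {i} z≤ eq = letter-injective λ j → case j Fin.≟ i of λ where
        (yes refl) → trans (letter-⊥ j) (sym eq)
        (no j≢i)   → trans (letter-⊥ j) (sym (zero-off {z} z≤ j≢i))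

      between : ∀ i z → ¬ (⊥ᵗ < z × z < atomAt i)
      between i z ((_ , ⊥≢z) , (z≤ , z≢)) with letter z i in eq
      ... | 0F = ⊥≢z (agree⊥ {z} z≤ eq)
      between zero    z ((_ , ⊥≢z) , (z≤ , z≢)) | 1F = z≢ (agree {z} z≤ eq)
      between (suc i) z ((_ , ⊥≢z) , (z≤ , z≢)) | 1F = T3 z (s≤s z≤n) (zero-off {z} {suc i} z≤ λ ()) eq
      between zero    z ((_ , ⊥≢z) , (z≤ , z≢)) | 2F = T2 z {zero} refl eq
      between (suc i) z ((_ , ⊥≢z) , (z≤ , z≢)) | 2F = z≢ (agree {z} z≤ (trans eq (sym (letter-atomAt i))))

    private
      initialWord : Fin (suc m) → Vec (Fin 3) (suc m)
      initialWord l = tabulate λ i → oneIf (i Fin.≤? l)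

      lookup-initialWord : ∀ l i → lookup (initialWord l) i ≡ oneIf (i Fin.≤? l)
      lookup-initialWord l i = Vec.lookup∘tabulate (λ i → oneIf (i Fin.≤? l)) i

    -- Positions start at 0, so `initial l` has one more 1 than the number `l`; the last of them is
    -- at `l`.
    initial : Fin (suc m) → Tri (suc m)
    initial l = tri (initialWord l) (mkIsTriword
      (λ i _ eq → oneIf≢2 (i Fin.≤? l) (trans (sym (lookup-initialWord l i)) eq))
      (λ i j i<j eq0 eq1 → ordered i<j (i Fin.≤? l) (j Fin.≤? l)
        (trans (sym (lookup-initialWord l i)) eq0) (trans (sym (lookup-initialWord l j)) eq1)))
      where
      ordered : ∀ {i j k} → i ℕ.< j → (p : Dec (i ℕ.≤ k)) (q : Dec (j ℕ.≤ k)) →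
                oneIf p ≡ 0F → oneIf q ≢ 1F
      ordered i<j (no i≰k) (yes j≤k) _ _ = i≰k (ℕ.<⇒≤ (ℕ.<-≤-trans i<j j≤k))
      ordered i<j (yes _) (yes _) ()
      ordered i<j _ (no _) _ ()

    letter-initial-≤ : ∀ {l i} → i Fin.≤ l → letter (initial l) i ≡ 1F
    letter-initial-≤ {l} {i} i≤l = trans (lookup-initialWord l i) (oneIf-yes (i Fin.≤? l) i≤l)

    letter-initial-> : ∀ {l i} → l Fin.< i → letter (initial l) i ≡ 0F
    letter-initial-> {l} {i} l<i = trans (lookup-initialWord l i) (oneIf-no (i Fin.≤? l) (ℕ.<⇒≱ l<i))

    letter-initial≢2 : ∀ {l} i → letter (initial l) i ≢ 2F
    letter-initial≢2 {l} i eq = oneIf≢2 (i Fin.≤? l) (trans (sym (lookup-initialWord l i)) eq)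

    initial-lastOne : ∀ l → LastOne (word (initial l)) l
    initial-lastOne l = letter-initial-≤ {l} Fin.≤-refl ,
      λ j l<j eq → case trans (sym (letter-initial-> l<j)) eq of λ ()

    initial-injective : ∀ {k l} → initial k ≡ initial l → k ≡ l
    initial-injective {k} {l} eq = Fin.≤-antisym (half eq) (half (sym eq))
      where
      half : ∀ {k l} → initial k ≡ initial l → k Fin.≤ l
      half {k} {l} eq = ℕ.≮⇒≥ λ l<k → case
        trans (sym (letter-initial-≤ {k} Fin.≤-refl))
          (trans (cong (λ u → letter u k) eq) (letter-initial-> l<k)) of λ ()

    initial≤ : ∀ {u l} → (∀ i → i Fin.≤ l → letter u i ≢ 0F) → initial l ≤ᵗ u
    initial≤ {u} {l} nonzero i = case i Fin.≤? l of λ where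
      (yes i≤l) → subst (Fin._≤ letter u i) (sym (letter-initial-≤ i≤l)) (≢0⇒1≤ (nonzero i i≤l))
      (no i≰l)  → subst (Fin._≤ letter u i) (sym (letter-initial-> (ℕ.≰⇒> i≰l))) z≤n

    -- The only coincidence between the two families of labels. Because of it, a last 1 contributes
    -- an atom exactly when it is the first letter.
    initial-zero : initial zero ≡ atomAt zero
    initial-zero = letter-injective λ where
      zero    → refl
      (suc i) → trans (letter-initial-> {zero} {suc i} (s≤s z≤n))
                      (sym (letter-atomAt-off {zero} {suc i} λ ()))

    initial-suc-¬Atom : ∀ {l} → ¬ Atom (initial (suc l))
    initial-suc-¬Atom {l} (_ , between) = between (initial zero)
      ( (subst (⊥ᵗ <_) (sym initial-zero) (proj₁ (atomAt-isAtom zero)))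
      , initial≤ {initial (suc l)} {zero}
          (λ i i≤0 → subst (_≢ 0F) (sym (letter-initial-≤ {suc l} {i} (ℕ.≤-trans i≤0 z≤n))) λ ())
      , λ eq → case initial-injective {zero} {suc l} eq of λ ())

    atomAt≢initial : ∀ {i l} → toℕ i ≢ 0 → atomAt i ≢ initial l
    atomAt≢initial {zero}  i≢0 _  = i≢0 refl
    atomAt≢initial {suc i} _   eq =
      letter-initial≢2 (suc i) (trans (sym (cong (λ u → letter u (suc i)) eq)) (letter-atomAt i))

    open FiniteLattice (Hoch (suc m)) using (_∨_)

    -- As `lower u i` differs from `u` only at `i`, its join with `d` is `u` iff `d ≤ᵗ u` and `d`
    -- agrees with `u` at `i`. The label is the least such `d`.
    lower-label : ∀ {u i c} → Removable u i → c ≤ᵗ u → letter u i Fin.≤ letter c i →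
                  (∀ d → d ≤ᵗ u → letter d i ≡ letter u i → c ≤ᵗ d) → IsLabel (lower u i) u c
    lower-label {u} {i} {c} r c≤u ui≤ci least = join , λ d eq → least d (d≤ d eq)
      ([ (λ l≡u → contradiction (lower-at {u = u} r) (Fin.<-irrefl l≡u)) , (λ d≡u → d≡u) ]′
        (∨-letter {u = lower u i} {d} eq i))
      where
      d≤ : ∀ d → lower u i ∨ d ≡ u → d ≤ᵗ u
      d≤ d eq = subst (d ≤ᵗ_) eq (proj₁ (proj₂ (supremum (lower u i) d)))

      above : u ≤ᵗ lower u i ∨ c
      above j = case j Fin.≟ i of λ where
        (yes refl) → ℕ.≤-trans ui≤ci (proj₁ (proj₂ (supremum (lower u i) c)) j)
        (no j≢i)   → subst (Fin._≤ letter (lower u i ∨ c) j) (lower-off {u = u} r j≢i)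
                           (proj₁ (supremum (lower u i) c) j)

      join : lower u i ∨ c ≡ u
      join = antisym (proj₂ (proj₂ (supremum (lower u i) c)) u (lower≤ {u = u} r) c≤u) above

    lower-label-two : ∀ {u i} → letter u i ≡ 2F → IsLabel (lower u i) u (atomAt i)
    lower-label-two {u} {zero}  eq = contradiction eq (T2 u refl)
    lower-label-two {u} {suc i} eq = lower-label {u} {suc i} {atomAt (suc i)} (inj₁ eq) (atomAt≤ {u} eq)
      (≡⇒≤ᵗ {u = u} {atomAt (suc i)} {suc i} (trans eq (sym (letter-atomAt i))))
      (λ d _ d≡u → atomAt≤ {d} (trans d≡u eq))
      where
      atomAt≤ : ∀ {v} → letter v (suc i) ≡ 2F → atomAt (suc i) ≤ᵗ v
      atomAt≤ {v} eq j with j Fin.≟ suc i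
      ... | yes refl = subst (letter (atomAt (suc i)) j Fin.≤_) (sym eq) ≤2
      ... | no j≢i   = subst (Fin._≤ letter v j) (sym (letter-atomAt-off j≢i)) z≤n

    nonzero-before : ∀ {u : Tri (suc m)} {l} → letter u l ≡ 1F → ∀ i → i Fin.≤ l → letter u i ≢ 0F
    nonzero-before {u} {l} eq i i≤l u≡0 with i Fin.≟ l
    ... | yes refl = case trans (sym eq) u≡0 of λ ()
    ... | no i≢l   = T3 u (Fin.≤∧≢⇒< i≤l i≢l) u≡0 eq

    lower-label-one : ∀ {u l} → LastOne (word u) l → IsLabel (lower u l) u (initial l)
    lower-label-one {u} {l} r@(eq , last) = lower-label {u} {l} {initial l} (inj₂ r)
      (initial≤ {u} (nonzero-before {u} eq))
      (≡⇒≤ᵗ {u = u} {initial l} {l} (trans eq (sym (letter-initial-≤ {l} Fin.≤-refl))))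
      (λ d _ d≡u → initial≤ {d} (nonzero-before {d} (trans d≡u eq)))

    -- A 2 may belong to either part. If the last 1 of `u` is at `k`, the possible `l` are `k` and
    -- the positions of the run of 2s directly after it; for `l` other than `k`, `initial l` is a
    -- label in the core of `u` without being a canonical joinand.
    Split : Tri (suc m) → Fin (suc m) → Set
    Split u l = (∀ i → i Fin.≤ l → letter u i ≢ 0F) × (∀ i → l Fin.< i → letter u i ≢ 1F)

    lastOne⇒split : ∀ {u l} → LastOne (word u) l → Split u l
    lastOne⇒split {u} (eq , last) = nonzero-before {u} eq , last

    Ψ-two : ∀ {u i} → letter u i ≡ 2F → Ψ u (atomAt i)
    Ψ-two {u} {i} eq = Can⊆Ψ {u} {atomAt i} (lower u i , lower-⋖ {u = u} (inj₁ eq) , lower-label-two {u} eq)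

    -- Meant for `z` a nucleus, which has no 2. From `k` on, the 0 at `k` excludes 1s as well, so
    -- `z` is 0 there, in particular at `l`; before that its letters are at most 1.
    ≤lower-initial : ∀ {z : Tri (suc m)} {k l} → k Fin.≤ l → letter z k ≡ 0F →
                     (∀ i → letter z i ≢ 2F) → z ≤ᵗ lower (initial l) l
    ≤lower-initial {z} {k} {l} k≤l z-k≡0 z≢2 =
      ≤lower {u = initial l} {l} {z} (inj₂ (initial-lastOne l)) z≤initial z<
      where
      z≡0 : ∀ i → l Fin.≤ i → letter z i ≡ 0F
      z≡0 i l≤i = case k Fin.≟ i of λ where
        (yes refl) → z-k≡0
        (no k≢i)   → ≢1∧≢2⇒≡0 (T3 z (Fin.≤∧≢⇒< (ℕ.≤-trans k≤l l≤i) k≢i) z-k≡0) (z≢2 i)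

      ≢2⇒≤1 : {a : Fin 3} → a ≢ 2F → a Fin.≤ Fin.suc (Fin.zero {1})
      ≢2⇒≤1 {0F} _ = z≤n
      ≢2⇒≤1 {1F} _ = s≤s z≤n
      ≢2⇒≤1 {2F} p = contradiction refl p

      z≤initial : z ≤ᵗ initial l
      z≤initial i = case i Fin.≤? l of λ where
        (yes i≤l) → subst (letter z i Fin.≤_) (sym (letter-initial-≤ i≤l)) (≢2⇒≤1 (z≢2 i))
        (no i≰l)  → subst (Fin._≤ letter (initial l) i) (sym (z≡0 i (ℕ.<⇒≤ (ℕ.≰⇒> i≰l)))) z≤n

      z< : letter z l Fin.< letter (initial l) l
      z< = subst (Fin._< letter (initial l) l) (sym (z≡0 l Fin.≤-refl))
        (≢0⇒1≤ (subst (_≢ 0F) (sym (letter-initial-≤ {l} Fin.≤-refl)) λ ()))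

    -- The witness is the cover below `initial l` itself. The nucleus has lost every 2 and the last
    -- 1 of `u`, and that 1 stands at some `k` up to `l`, so `≤lower-initial` places this cover
    -- inside the core.
    Ψ-split : ∀ {u l} → Split u l → Ψ u (initial l)
    Ψ-split {u} {l} (nonzero , no1) =
      let k , last = lastOne in
      lower (initial l) l , initial l , ≤lower-initial {nucleus u} {k} (k≤l last) (nucleus-k≡0 last) nucleus≢2 ,
      lower-⋖ {u = initial l} (inj₂ (initial-lastOne l)) , initial≤ {u} nonzero ,
      lower-label-one {initial l} (initial-lastOne l)
      where
      nucleus< : ∀ {i} → Removable u i → letter (nucleus u) i Fin.< letter u i
      nucleus< {i} r = ℕ.≤-<-trans (nucleus≤cover {u} (lower-⋖ {u = u} r) i) (lower-at {u = u} r)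

      nucleus≢2 : ∀ i → letter (nucleus u) i ≢ 2F
      nucleus≢2 i z≡2 = Fin.<-irrefl (trans z≡2 (sym u≡2)) (nucleus< (inj₁ u≡2))
        where u≡2 = 2≤⇒≡2 (subst (Fin._≤ letter u i) z≡2 (nucleus≤ u i))

      lastOne : ∃ (LastOne (word u))
      lastOne = case noOnes⊎lastOne (word u) of λ where
        (inj₁ none) → contradiction (≢0∧≢2⇒≡1 (nonzero zero z≤n) (T2 u refl)) (none zero)
        (inj₂ last) → last

      k≤l : ∀ {k} → LastOne (word u) k → k Fin.≤ l
      k≤l last = ℕ.≮⇒≥ λ l<k → no1 _ l<k (proj₁ last)

      nucleus-k≡0 : ∀ {k} → LastOne (word u) k → letter (nucleus u) k ≡ 0F
      nucleus-k≡0 {k} last = ≤0⇒≡0 (ℕ.≤-pred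
        (subst (letter (nucleus u) k Fin.<_) (proj₁ last) (nucleus< (inj₂ last))))

    -- Unless `j` is `k`, the 1 at `k` survives and excludes 0s before it; if `j` is `k`, the
    -- letters up to `l` are untouched.
    initial≤lower : ∀ {u j k l} → letter u k ≡ 1F → l Fin.< k → Removable u j → initial l ≤ᵗ lower u j
    initial≤lower {u} {j} {k} {l} u≡1 l<k r = initial≤ {lower u j} λ i i≤l w≡0 →
      case (i Fin.≟ j) , (k Fin.≟ j) of λ where
        (no i≢j   , _)        → nonzero-before {u} u≡1 i (ℕ.≤-trans i≤l (ℕ.<⇒≤ l<k))
                                  (trans (sym (lower-off {u = u} r i≢j)) w≡0)
        (yes refl , yes refl) → ℕ.<⇒≱ l<k i≤l
        (yes refl , no k≢j)   → T3 (lower u j) (ℕ.≤-<-trans i≤l l<k) w≡0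
                                  (trans (lower-off {u = u} r k≢j) u≡1)

    initial≤nucleus : ∀ {u k l} → letter u k ≡ 1F → l Fin.< k → initial l ≤ᵗ nucleus u
    initial≤nucleus {u} {k} {l} u≡1 l<k = ≤nucleus {u} {initial l}
      (initial≤ {u} λ i i≤l → nonzero-before {u} u≡1 i (ℕ.≤-trans i≤l (ℕ.<⇒≤ l<k)))
      (λ {w} w⋖u → let j , r , eq = ⋖⇒lower {w = w} {u} w⋖u in
        subst (initial l ≤ᵗ_) (sym eq) (initial≤lower {u} {j} u≡1 l<k r))

    Ψ⇒ : ∀ {u c} → Ψ u c → (∃[ i ] (letter u i ≡ 2F × c ≡ atomAt i)) ⊎ (∃[ l ] (Split u l × c ≡ initial l))
    Ψ⇒ {u} {c} (b , v , nuc≤b , b⋖v , v≤u , label) =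
      let i , r , eq = ⋖⇒lower {w = b} {v} b⋖v
      in from-lower r (subst (nucleus u ≤ᵗ_) eq nuc≤b) (subst (λ b → IsLabel b v c) eq label)
      where
      from-lower : ∀ {i} → Removable v i → nucleus u ≤ᵗ lower v i → IsLabel (lower v i) v c →
        (∃[ i ] (letter u i ≡ 2F × c ≡ atomAt i)) ⊎ (∃[ l ] (Split u l × c ≡ initial l))
      from-lower {i} (inj₁ eq) _ label = inj₁ (i , 2≤⇒≡2 (subst (Fin._≤ letter u i) eq (v≤u i)) ,
        IsLabel-unique {lower v i} {v} label (lower-label-two {v} eq))
      from-lower {l} (inj₂ last) nuc≤ label = inj₂ (l , (nonzero , no1) ,
        IsLabel-unique {lower v l} {v} label (lower-label-one {v} last))
        where
        nonzero : ∀ i → i Fin.≤ l → letter u i ≢ 0F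
        nonzero i i≤l u≡0 = nonzero-before {v} (proj₁ last) i i≤l
          (≤0⇒≡0 (subst (letter v i Fin.≤_) u≡0 (v≤u i)))

        -- A 1 of `u` beyond `l` would put `initial l` below `nucleus u` and hence below
        -- `lower v l`, whose letter at `l` is less than 1.
        no1 : ∀ k → l Fin.< k → letter u k ≢ 1F
        no1 k l<k u≡1 = ℕ.<⇒≱
          (subst (letter (lower v l) l Fin.<_) (trans (proj₁ last) (sym (letter-initial-≤ {l} Fin.≤-refl)))
                 (lower-at {u = v} (inj₂ last)))
          (ℕ.≤-trans (initial≤nucleus {u} u≡1 l<k l) (nuc≤ l))

    ⊑⇒two : ∀ {u v} → u ⊑ v → ∀ i → letter u i ≡ 2F → letter v i ≡ 2F
    ⊑⇒two {u} {v} u⊑v i eq = case Ψ⇒ {v} {atomAt i} (u⊑v {atomAt i} (Ψ-two {u} {i} eq)) of λ where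
      (inj₁ (j , eq′ , a≡)) → subst (λ i → letter v i ≡ 2F) (sym (atomAt-injective a≡)) eq′
      (inj₂ (l , _ , a≡))   → contradiction a≡ (atomAt≢initial λ i≡0 → T2 u i≡0 eq)

    ⊑⇒split : ∀ {u v l} → u ⊑ v → Split u l → Split v l
    ⊑⇒split {u} {v} {l} u⊑v split = case Ψ⇒ {v} {initial l} (u⊑v {initial l} (Ψ-split {u} {l} split)) of λ where
      (inj₁ (j , eq , a≡))     → contradiction (sym a≡) (atomAt≢initial λ j≡0 → T2 v j≡0 eq)
      (inj₂ (_ , split′ , i≡)) → subst (Split v) (sym (initial-injective i≡)) split′

    -- A common split point determines every letter other than 2: it is 1 up to `l` and 0
    -- afterwards.
    split-letters : ∀ {u v l} → (∀ i → letter u i ≡ 2F → letter v i ≡ 2F) → Split u l → Split v l →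
                    ∀ i → letter v i ≡ letter u i ⊎ letter v i ≡ 2F
    split-letters {u} {v} {l} two (u≢0 , u≢1) (v≢0 , v≢1) i with letter v i Fin.≟ 2F | i Fin.≤? l
    ... | yes v≡2 | _ = inj₂ v≡2
    ... | no v≢2 | yes i≤l =
      inj₁ (trans (≢0∧≢2⇒≡1 (v≢0 i i≤l) v≢2) (sym (≢0∧≢2⇒≡1 (u≢0 i i≤l) (v≢2 ∘ two i))))
    ... | no v≢2 | no i≰l  =
      inj₁ (trans (≢1∧≢2⇒≡0 (v≢1 i l<i) v≢2) (sym (≢1∧≢2⇒≡0 (u≢1 i l<i) (v≢2 ∘ two i))))
      where l<i = ℕ.≰⇒> i≰l

    ⊑⇒letters : ∀ {u v} → u ⊑ v → letter u zero ≡ 1F → ∀ i → letter v i ≡ letter u i ⊎ letter v i ≡ 2F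
    ⊑⇒letters {u} {v} u⊑v u₀ = case noOnes⊎lastOne (word u) of λ where
      (inj₁ none)       → contradiction u₀ (none zero)
      (inj₂ (l , last)) → let split = lastOne⇒split {u} {l} last in
        split-letters {u} {v} {l} (⊑⇒two {u} {v} λ {c} → u⊑v {c}) split (⊑⇒split {u} {v} {l} (λ {c} → u⊑v {c}) split)

    ⇒⊑ : ∀ {u v} → (∀ i → letter u i ≡ 2F → letter v i ≡ 2F) →
          (letter u zero ≡ 1F → ∀ i → letter v i ≡ letter u i ⊎ letter v i ≡ 2F) → u ⊑ v
    ⇒⊑ {u} {v} two letters {c} Ψc = case Ψ⇒ {u} {c} Ψc of λ
      { (inj₁ (i , eq , c≡))    → subst (Ψ v) (sym c≡) (Ψ-two {v} {i} (two i eq))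
      ; (inj₂ (l , split , c≡)) → subst (Ψ v) (sym c≡) (Ψ-split {v} {l} (split-v split))
      }
      where
      split-v : ∀ {l} → Split u l → Split v l
      split-v (nonzero , no1) = nonzero-v , no1-v
        where
        -- The first position lies in the left part of every split, and (T2) excludes a 2 there, so
        -- a split forces the first letter to be 1.
        letters′ = letters (≢0∧≢2⇒≡1 (nonzero zero z≤n) (T2 u refl))
        nonzero-v : ∀ i → i Fin.≤ _ → letter v i ≢ 0F
        nonzero-v i i≤l v≡0 = [ (λ eq → nonzero i i≤l (trans (sym eq) v≡0))
                              , (λ eq → case trans (sym eq) v≡0 of λ ()) ]′ (letters′ i)
        no1-v : ∀ i → _ Fin.< i → letter v i ≢ 1F
        no1-v i l<i v≡1 = [ (λ eq → no1 i l<i (trans (sym eq) v≡1))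
                          , (λ eq → case trans (sym eq) v≡1 of λ ()) ]′ (letters′ i)

  -- Counting lower covers and canonical atoms by position

  module _ {A B : Set} where

    map-unique : {g : A → B} {xs : List A} →
      (∀ {x y} → x ∈ xs → y ∈ xs → g x ≡ g y → x ≡ y) → Unique xs → Unique (map g xs)
    map-unique inj []           = []
    map-unique inj (x∉ ∷ xs!) =
      All.map⁺ (All.tabulate λ y∈ gx≡gy → All.lookup x∉ y∈ (inj (here refl) (there y∈) gx≡gy)) ∷
      map-unique (λ x∈ y∈ → inj (there x∈) (there y∈)) xs!

    length-image : {g : A → B} {xs : List A} {ys : List B} → Unique xs → Unique ys →
      (∀ {x y} → x ∈ xs → y ∈ xs → g x ≡ g y → x ≡ y) →
      (∀ {x} → x ∈ xs → g x ∈ ys) → (∀ {y} → y ∈ ys → ∃[ x ] (x ∈ xs × y ≡ g x)) →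
      length ys ≡ length xs
    length-image {g} {xs} xs! ys! inj to from = trans
      (↭-length (∼bag⇒↭ (unique∧set⇒bag ys! (map-unique inj xs!)
        (mk⇔ (λ y∈ → let x , x∈ , y≡ = from y∈ in subst (_∈ map g xs) (sym y≡) (∈-map⁺ g x∈))
             (λ y∈ → let x , x∈ , y≡ = ∈-map⁻ g y∈ in subst (_∈ _) (sym y≡) (to x∈))))))
      (List.length-map g xs)

  isTwo : Fin 3 → Bool
  isTwo 0F = false
  isTwo 1F = false
  isTwo 2F = true

  twos : ∀ {m} → Vec (Fin 3) m → Subset m
  twos = Vec.map isTwo

  positions : ∀ {m} → Vec (Fin 3) m → List (Fin m)
  positions []       = []
  positions (2F ∷ w) = zero ∷ map Fin.suc (positions w)
  positions (0F ∷ w) = map Fin.suc (positions w)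
  positions (1F ∷ w) = map Fin.suc (positions w)

  length-positions : ∀ {m} (w : Vec (Fin 3) m) → length (positions w) ≡ ∣ twos w ∣
  length-positions []       = refl
  length-positions (0F ∷ w) = trans (List.length-map Fin.suc (positions w)) (length-positions w)
  length-positions (1F ∷ w) = trans (List.length-map Fin.suc (positions w)) (length-positions w)
  length-positions (2F ∷ w) = cong suc (trans (List.length-map Fin.suc (positions w)) (length-positions w))

  ∈-positions⁺ : ∀ {m} {w : Vec (Fin 3) m} {i} → lookup w i ≡ 2F → i ∈ positions w
  ∈-positions⁺ {w = 2F ∷ w} {zero}  eq = here refl
  ∈-positions⁺ {w = 0F ∷ w} {suc i} eq = ∈-map⁺ suc (∈-positions⁺ {w = w} eq)
  ∈-positions⁺ {w = 1F ∷ w} {suc i} eq = ∈-map⁺ suc (∈-positions⁺ {w = w} eq)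
  ∈-positions⁺ {w = 2F ∷ w} {suc i} eq = there (∈-map⁺ suc (∈-positions⁺ {w = w} eq))

  mutual
    ∈-positions⁻ : ∀ {m} {w : Vec (Fin 3) m} {i} → i ∈ positions w → lookup w i ≡ 2F
    ∈-positions⁻ {w = 0F ∷ w} i∈         = ∈-map-suc-positions⁻ {w = w} i∈
    ∈-positions⁻ {w = 1F ∷ w} i∈         = ∈-map-suc-positions⁻ {w = w} i∈
    ∈-positions⁻ {w = 2F ∷ w} (here refl) = refl
    ∈-positions⁻ {w = 2F ∷ w} (there i∈)  = ∈-map-suc-positions⁻ {w = w} i∈

    ∈-map-suc-positions⁻ : ∀ {m} {w : Vec (Fin 3) m} {a i} → i ∈ map Fin.suc (positions w) → lookup (a ∷ w) i ≡ 2F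
    ∈-map-suc-positions⁻ {w = w} i∈ with j , j∈ , refl ← ∈-map⁻ suc i∈ = ∈-positions⁻ {w = w} j∈

  zero∉map-suc : ∀ {m} (is : List (Fin m)) → All.All (Fin.zero ≢_) (map Fin.suc is)
  zero∉map-suc is = All.map⁺ (All.universal (λ _ ()) is)

  map-suc-unique : ∀ {m} {is : List (Fin m)} → Unique is → Unique (map Fin.suc is)
  map-suc-unique = Unique.map⁺ Fin.suc-injective

  positions-unique : ∀ {m} (w : Vec (Fin 3) m) → Unique (positions w)
  positions-unique []       = []
  positions-unique (0F ∷ w) = map-suc-unique (positions-unique w)
  positions-unique (1F ∷ w) = map-suc-unique (positions-unique w)
  positions-unique (2F ∷ w) = zero∉map-suc (positions w) ∷ map-suc-unique (positions-unique w)

  module _ {m : ℕ} where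
    open FiniteLattice (Hoch (suc m)) using (_⋖?_; elements; complete; unique)
    open Hochschild (suc m)
    open Nucleus (Hoch (suc m))

    -- The removable positions whose label is an atom. `firstOne` is present because `initial zero`
    -- is an atom; a last 1 further right has a label that is not.
    data AtomPosition (u : Tri (suc m)) : Fin (suc m) → Set where
      twoAt    : ∀ {i} → letter u i ≡ 2F → AtomPosition u i
      firstOne : LastOne (word u) zero → AtomPosition u zero

    AtomPosition⇒Removable : ∀ {u i} → AtomPosition u i → Removable u i
    AtomPosition⇒Removable (twoAt eq)     = inj₁ eq
    AtomPosition⇒Removable (firstOne last) = inj₂ last

    AtomPosition⇒IsLabel : ∀ {u i} → AtomPosition u i → IsLabel (lower u i) u (atomAt i)
    AtomPosition⇒IsLabel {u} {i} (twoAt eq)     = lower-label-two {m} {u} {i} eq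
    AtomPosition⇒IsLabel {u} {i} (firstOne last) =
      subst (IsLabel (lower u zero) u) initial-zero (lower-label-one {m} {u} {zero} last)

    label-Atom⇒AtomPosition : ∀ {u i c} → Removable u i → IsLabel (lower u i) u c → Atom c →
                              AtomPosition u i × c ≡ atomAt i
    label-Atom⇒AtomPosition {u} {i} {c} (inj₁ eq) label _ =
      twoAt eq , IsLabel-unique {lower u i} {u} label (lower-label-two {m} {u} eq)
    label-Atom⇒AtomPosition {u} {zero} {c} (inj₂ last) label _ = firstOne last ,
      trans (IsLabel-unique {lower u zero} {u} label (lower-label-one {m} {u} last)) initial-zero
    label-Atom⇒AtomPosition {u} {suc l} {c} (inj₂ last) label atom =
      contradiction (subst Atom (IsLabel-unique {lower u (suc l)} {u} label (lower-label-one {m} {u} last)) atom)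
                    (initial-suc-¬Atom {m} {l})

    lower-injective : ∀ {u : Tri (suc m)} {i j} → Removable u i → Removable u j → lower u i ≡ lower u j → i ≡ j
    lower-injective {u} {i} {j} ri rj eq = case i Fin.≟ j of λ where
      (yes i≡j) → i≡j
      (no i≢j)  → contradiction (lower-at {u = u} ri)
        (Fin.<-irrefl (trans (cong (λ v → letter v i) eq) (lower-off {u = u} rj i≢j)))

    module _ {u : Tri (suc m)} {is : List (Fin (suc m))} (is! : Unique is)
             (∈is⇒ : ∀ {i} → i ∈ is → AtomPosition u i) (⇒∈is : ∀ {i} → AtomPosition u i → i ∈ is) where

      neg≡length : neg u ≡ length is
      neg≡length = length-image {g = atomAt} is!
        (Unique.filter⁺ canAtom? unique) (λ _ _ → atomAt-injective)
        (λ {i} i∈ → ∈-filter⁺ canAtom? (complete (atomAt i))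
          ((lower u i , lower-⋖ {u = u} (AtomPosition⇒Removable {u} (∈is⇒ i∈)) ,
           AtomPosition⇒IsLabel {u} (∈is⇒ i∈)) ,
           atomAt-isAtom i))
        (λ {c} c∈ → from (proj₂ (∈-filter⁻ canAtom? {xs = elements} c∈)))
        where
        canAtom? = λ c → Can? u c ×-dec Atom? c
        from : ∀ {c} → Can u c × Atom c → ∃[ i ] (i ∈ is × c ≡ atomAt i)
        from {c} ((b , b⋖u , label) , atom) =
          let i , r , b≡ = ⋖⇒lower {w = b} {u} b⋖u
              pos , c≡ = label-Atom⇒AtomPosition {u} r (subst (λ b → IsLabel b u c) b≡ label) atom
          in i , ⇒∈is pos , c≡

    Cov↓-unique : ∀ u → Unique (Cov↓ u)
    Cov↓-unique u = Unique.filter⁺ (_⋖? u) unique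

    length-covers : ∀ {u is} {P : Tri (suc m) → Set} (P? : Unary.Decidable P) → Unique is →
      (∀ {i} → i ∈ is → Removable u i × P (lower u i)) →
      (∀ {i} → Removable u i → P (lower u i) → i ∈ is) →
      length (filter P? (Cov↓ u)) ≡ length is
    length-covers {u} {is} {P} P? is! ∈is⇒ ⇒∈is = length-image {g = lower u} is!
      (Unique.filter⁺ P? (Cov↓-unique u))
      (λ i∈ j∈ → lower-injective {u} (proj₁ (∈is⇒ i∈)) (proj₁ (∈is⇒ j∈)))
      (λ i∈ → let r , p = ∈is⇒ i∈ in ∈-filter⁺ P? (∈Cov↓ (lower-⋖ {u = u} r)) p)
      (λ {w} w∈ →
        let w∈Cov , p = ∈-filter⁻ P? {xs = Cov↓ u} w∈
            i , r , w≡ = ⋖⇒lower {w = w} {u} (proj₂ (∈-filter⁻ (_⋖? u) {xs = elements} w∈Cov))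
        in i , ⇒∈is r (subst P w≡ p) , w≡)

    AtomPosition⇒AtomLabel : ∀ {u i} → AtomPosition u i → AtomLabel (lower u i) u
    AtomPosition⇒AtomLabel {u} {i} pos = atomAt i , AtomPosition⇒IsLabel {u} pos , atomAt-isAtom i

    AtomLabel⇒AtomPosition : ∀ {u i} → Removable u i → AtomLabel (lower u i) u → AtomPosition u i
    AtomLabel⇒AtomPosition {u} r (c , label , atom) = proj₁ (label-Atom⇒AtomPosition {u} r label atom)

    -- `neg` counts labels, whereas the subtrahend of `neg~` counts covers. Both numbers come from
    -- the same list of positions, which is why one `p` serves for the two.
    record CoverCounts (u : Tri (suc m)) (p q : ℕ) : Set where
      field
        neg≡      : neg u ≡ p
        atoms≡    : length (filter (λ u′ → atomLabel? u′ u) (Cov↓ u)) ≡ p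
        nonatoms≡ : length (filter (λ u′ → ¬? (atomLabel? u′ u)) (Cov↓ u)) ≡ q

    coverCounts : ∀ {u is js} → Unique is → Unique js →
      (∀ {i} → i ∈ is → AtomPosition u i) → (∀ {i} → AtomPosition u i → i ∈ is) →
      (∀ {j} → j ∈ js → Removable u j × ¬ AtomPosition u j) →
      (∀ {j} → Removable u j → ¬ AtomPosition u j → j ∈ js) →
      CoverCounts u (length is) (length js)
    coverCounts {u} {is} {js} is! js! ∈is⇒ ⇒∈is ∈js⇒ ⇒∈js = record
      { neg≡      = neg≡length {u} is! ∈is⇒ ⇒∈is
      ; atoms≡    = length-covers {u} (λ u′ → atomLabel? u′ u) is!
          (λ i∈ → AtomPosition⇒Removable {u} (∈is⇒ i∈) , AtomPosition⇒AtomLabel {u} (∈is⇒ i∈))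
          (λ r atom → ⇒∈is (AtomLabel⇒AtomPosition {u} r atom))
      ; nonatoms≡ = length-covers {u} (λ u′ → ¬? (atomLabel? u′ u)) js!
          (λ j∈ → let r , ¬pos = ∈js⇒ j∈ in r , ¬pos ∘ AtomLabel⇒AtomPosition {u} r)
          (λ r ¬atom → ⇒∈js r (¬atom ∘ AtomPosition⇒AtomLabel {u}))
      }

    tail : Tri (suc m) → Vec (Fin 3) m
    tail u = Vec.tail (word u)

    ∈twos⁺ : ∀ {u} i → letter u i ≡ 2F → i ∈ map Fin.suc (positions (tail u))
    ∈twos⁺ {u}           zero    eq = contradiction eq (T2 u refl)
    ∈twos⁺ {tri (a ∷ w) _} (suc i) eq = ∈-map⁺ suc (∈-positions⁺ {w = w} eq)

    ∈twos⁻ : ∀ {u i} → i ∈ map Fin.suc (positions (tail u)) → letter u i ≡ 2F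
    ∈twos⁻ {tri (a ∷ w) _} = ∈-map-suc-positions⁻ {w = w}

    length-twos : ∀ (u : Tri (suc m)) → length (map Fin.suc (positions (tail u))) ≡ ∣ twos (tail u) ∣
    length-twos u = trans (List.length-map Fin.suc (positions (tail u))) (length-positions (tail u))

    0-head⇒NoOnes : ∀ {u : Tri (suc m)} → letter u zero ≡ 0F → NoOnes (word u)
    0-head⇒NoOnes {u} u₀ zero    eq = case trans (sym u₀) eq of λ ()
    0-head⇒NoOnes {u} u₀ (suc i) eq = T3 u (s≤s z≤n) u₀ eq

    twos! : ∀ u → Unique (map Fin.suc (positions (tail u)))
    twos! u = map-suc-unique (positions-unique (tail u))

    coverCounts-0 : ∀ u → letter u zero ≡ 0F → CoverCounts u ∣ twos (tail u) ∣ 0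
    coverCounts-0 u u₀ = subst (λ p → CoverCounts u p 0) (length-twos u)
      (coverCounts {u} {js = []} (twos! u) [] (twoAt ∘ ∈twos⁻ {u})
        (λ { {i} (twoAt eq) → ∈twos⁺ {u} i eq ; (firstOne last) → contradiction (proj₁ last) (none zero) })
        (λ ())
        (λ { (inj₁ eq) ¬pos → contradiction (twoAt eq) ¬pos
           ; {j} (inj₂ last) _ → contradiction (proj₁ last) (none j) }))
      where none = 0-head⇒NoOnes {u} u₀

    -- Here the last 1 is the first letter, and its label is one more atom besides those of the 2s.
    coverCounts-1 : ∀ u → letter u zero ≡ 1F → NoOnes (tail u) → CoverCounts u (suc ∣ twos (tail u) ∣) 0
    coverCounts-1 u@(tri (_ ∷ _) _) u₀ none = subst (λ p → CoverCounts u p 0) (cong suc (length-twos u))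
      (coverCounts {u} {js = []} (zero∉map-suc (positions (tail u)) ∷ twos! u) []
        (λ { (here refl) → firstOne last ; (there i∈) → twoAt (∈twos⁻ {u} i∈) })
        (λ { {i} (twoAt eq) → there (∈twos⁺ {u} i eq) ; (firstOne _) → here refl })
        (λ ())
        (λ { (inj₁ eq) ¬pos → contradiction (twoAt eq) ¬pos
           ; {zero}  (inj₂ last) ¬pos → contradiction (firstOne last) ¬pos
           ; {suc j} (inj₂ last) _    → contradiction (proj₁ last) (none j) }))
      where
      last : LastOne (word u) zero
      last = u₀ , λ { (suc j) _ → none j }

    -- The last 1 stands beyond the first position, so the cover that decreases it is the only one
    -- whose label is not an atom.
    coverCounts-1⋯1 : ∀ u → ∃ (LastOne (tail u)) → CoverCounts u ∣ twos (tail u) ∣ 1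
    coverCounts-1⋯1 u@(tri (_ ∷ _) _) (k , u≡1 , last) = subst (λ p → CoverCounts u p 1) (length-twos u)
      (coverCounts {u} {js = suc k ∷ []} (twos! u) (All.[] ∷ []) (twoAt ∘ ∈twos⁻ {u})
        (λ { {i} (twoAt eq) → ∈twos⁺ {u} i eq
           ; (firstOne (_ , last₀)) → contradiction u≡1 (last₀ (suc k) (s≤s z≤n)) })
        (λ { (here refl) → inj₂ last-k , λ { (twoAt eq) → case trans (sym u≡1) eq of λ () } })
        (λ { (inj₁ eq) ¬pos → contradiction (twoAt eq) ¬pos
           ; {j} (inj₂ last-j) _ → here (LastOne-unique last-j last-k) }))
      where
      last-k : LastOne (word u) (suc k)
      last-k = u≡1 , λ { (suc j) (s≤s k<j) → last j k<j }

      LastOne-unique : ∀ {i j} → LastOne (word u) i → LastOne (word u) j → i ≡ j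
      LastOne-unique (i≡1 , last-i) (j≡1 , last-j) = Fin.≤-antisym
        (ℕ.≮⇒≥ λ j<i → last-j _ j<i i≡1) (ℕ.≮⇒≥ λ i<j → last-i _ i<j j≡1)

  -- Antisymmetry and rank in the core label order

  forget : Fin 3 → Fin 3
  forget 0F = 0F
  forget 1F = 0F
  forget 2F = 2F

  forget≢1 : ∀ a → forget a ≢ 1F
  forget≢1 0F ()
  forget≢1 1F ()
  forget≢1 2F ()

  forget≡2⁻ : ∀ {a} → forget a ≡ 2F → a ≡ 2F
  forget≡2⁻ {2F} _ = refl

  twos-forget : ∀ {m} (w : Vec (Fin 3) m) → twos (Vec.map forget w) ≡ twos w
  twos-forget []       = refl
  twos-forget (0F ∷ w) = cong (false ∷_) (twos-forget w)
  twos-forget (1F ∷ w) = cong (false ∷_) (twos-forget w)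
  twos-forget (2F ∷ w) = cong (true ∷_) (twos-forget w)

  ∣twos∣≡0 : ∀ {m} (w : Vec (Fin 3) m) → ∣ twos w ∣ ≡ 0 → ∀ i → lookup w i ≢ 2F
  ∣twos∣≡0 (0F ∷ w) eq (suc i) = ∣twos∣≡0 w eq i
  ∣twos∣≡0 (1F ∷ w) eq (suc i) = ∣twos∣≡0 w eq i
  ∣twos∣≡0 (0F ∷ w) eq zero    = λ ()
  ∣twos∣≡0 (1F ∷ w) eq zero    = λ ()
  ∣twos∣≡0 (2F ∷ w) ()

  ∣twos∣≡suc : ∀ {m k} (w : Vec (Fin 3) m) → ∣ twos w ∣ ≡ suc k →
               ∃[ i ] (lookup w i ≡ 2F × ∣ twos (w [ i ]≔ 0F) ∣ ≡ k)
  ∣twos∣≡suc (0F ∷ w) eq = let i , w≡2 , eq′ = ∣twos∣≡suc w eq in suc i , w≡2 , eq′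
  ∣twos∣≡suc (1F ∷ w) eq = let i , w≡2 , eq′ = ∣twos∣≡suc w eq in suc i , w≡2 , eq′
  ∣twos∣≡suc (2F ∷ w) eq = zero , refl , ℕ.suc-injective eq

  module _ {m : ℕ} where
    open Hochschild (suc m)

    SameTwos : Tri (suc m) → Tri (suc m) → Set
    SameTwos u v = ∀ i → (letter u i ≡ 2F → letter v i ≡ 2F) × (letter v i ≡ 2F → letter u i ≡ 2F)

    ⊑⊒⇒SameTwos : ∀ {u v} → u ⊑ v → v ⊑ u → SameTwos u v
    ⊑⊒⇒SameTwos {u} {v} u⊑v v⊑u i =
      ⊑⇒two {m} {u} {v} (λ {c} → u⊑v {c}) i , ⊑⇒two {m} {v} {u} (λ {c} → v⊑u {c}) i

    head≢1⇒NoOnes : ∀ {u : Tri (suc m)} → letter u zero ≢ 1F → NoOnes (word u)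
    head≢1⇒NoOnes {u} u₀≢1 = 0-head⇒NoOnes {m} {u} (≢1∧≢2⇒≡0 u₀≢1 (T2 u refl))

    NoOnes-≡ : ∀ {u v} → NoOnes (word u) → NoOnes (word v) → SameTwos u v → u ≡ v
    NoOnes-≡ {u} {v} u≢1 v≢1 same = letter-injective λ i → case letter u i Fin.≟ 2F of λ where
      (yes u≡2) → trans u≡2 (sym (proj₁ (same i) u≡2))
      (no u≢2)  → trans (≢1∧≢2⇒≡0 (u≢1 i) u≢2) (sym (≢1∧≢2⇒≡0 (v≢1 i) (u≢2 ∘ proj₂ (same i))))

    1-head-≡ : ∀ {u v} → letter u zero ≡ 1F → u ⊑ v → SameTwos u v → u ≡ v
    1-head-≡ {u} {v} u₀ u⊑v same = letter-injective λ i →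
      case ⊑⇒letters {m} {u} {v} (λ {c} → u⊑v {c}) u₀ i of λ where
        (inj₁ v≡u) → sym v≡u
        (inj₂ v≡2) → trans (proj₂ (same i) v≡2) (sym v≡2)

    -- The 2s of `u` and `v` coincide. If one of the two begins with 1, `⊑⇒letters` transfers its
    -- remaining letters to the other; if neither does, there are no 1s and the 2s determine the
    -- triword.
    ⊑-antisym : ∀ {u v} → u ⊑ v → v ⊑ u → u ≡ v
    ⊑-antisym {u} {v} u⊑v v⊑u = case (letter u zero Fin.≟ 1F) , (letter v zero Fin.≟ 1F) of λ
      { (yes u₀ , _)      → 1-head-≡ {u} {v} u₀ (λ {c} → u⊑v {c}) same
      ; (no _   , yes v₀) → sym (1-head-≡ {v} {u} v₀ (λ {c} → v⊑u {c}) λ i → proj₂ (same i) , proj₁ (same i))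
      ; (no u₀  , no v₀)  → NoOnes-≡ {u} {v} (head≢1⇒NoOnes {u} u₀) (head≢1⇒NoOnes {v} v₀) same
      }
      where same = ⊑⊒⇒SameTwos {u} {v} (λ {c} → u⊑v {c}) (λ {c} → v⊑u {c})

    NoOnes⇒⊑ : ∀ {u v} → NoOnes (word u) → (∀ i → letter u i ≡ 2F → letter v i ≡ 2F) → u ⊑ v
    NoOnes⇒⊑ {u} {v} none two {c} = ⇒⊑ {m} {u} {v} two (λ u₀ → contradiction u₀ (none zero)) {c}

    0-head-below : ∀ {u v} → u ⊑ v → NoOnes (word v) → NoOnes (word u)
    0-head-below {u} {v} u⊑v none = head≢1⇒NoOnes {u} λ u₀ →
      case ⊑⇒letters {m} {u} {v} (λ {c} → u⊑v {c}) u₀ zero of λ where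
        (inj₁ v≡u) → none zero (trans v≡u u₀)
        (inj₂ v≡2) → T2 v refl v≡2

    -- Everything `⊑ u` again has no 1s by `0-head-below`, and among triwords without 1s the order
    -- is inclusion of the sets of 2s.
    remove-two-⋖ : ∀ {u v i} → NoOnes (word u) → letter u i ≡ 2F → letter v i ≡ 0F →
                   (∀ {j} → j ≢ i → letter v j ≡ letter u j) → v CLO.⋖ u
    remove-two-⋖ {u} {v} {i} none-u u≡2 v≡0 off =
      ((λ {c} → v⊑u {c}) , v≢u) , between
      where
      none-v : NoOnes (word v)
      none-v j = case j Fin.≟ i of λ where
        (yes refl) → λ v≡1 → case trans (sym v≡0) v≡1 of λ ()
        (no j≢i)   → none-u j ∘ trans (sym (off j≢i))

      v≢u : v ≢ u
      v≢u eq = case trans (sym v≡0) (trans (cong (λ v → letter v i) eq) u≡2) of λ ()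

      v⊑u : v ⊑ u
      v⊑u {c} = NoOnes⇒⊑ {v} {u} none-v (λ j v≡2 → case j Fin.≟ i of λ where
        (yes refl) → u≡2
        (no j≢i)   → trans (sym (off j≢i)) v≡2) {c}

      between : ∀ z → ¬ (v CLO.< z × z CLO.< u)
      between z ((v⊑z , v≢z) , (z⊑u , z≢u)) = case letter z i Fin.≟ 2F of λ
          { (yes z≡2) → z≢u (NoOnes-≡ {z} {u} none-z none-u λ j →
            z⇒u j , λ u≡2 → case j Fin.≟ i of λ where
              (yes refl) → z≡2
              (no j≢i)   → v⇒z j (trans (off j≢i) u≡2))
          ; (no z≢2)  → v≢z (NoOnes-≡ {v} {z} none-v none-z λ j →
            v⇒z j , λ z≡2 → case j Fin.≟ i of λ where
              (yes refl) → contradiction z≡2 z≢2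
              (no j≢i)   → trans (off j≢i) (z⇒u j z≡2))
          }
        where
        none-z : NoOnes (word z)
        none-z = 0-head-below {z} {u} (λ {c} → z⊑u {c}) none-u
        v⇒z = ⊑⇒two {m} {v} {z} (λ {c} → v⊑z {c})
        z⇒u = ⊑⇒two {m} {z} {u} (λ {c} → z⊑u {c})

    forgetOnes : Tri (suc m) → Tri (suc m)
    forgetOnes u = tri (Vec.map forget (word u)) (mkIsTriword
      (λ i i≡0 eq → T2 u i≡0 (forget≡2⁻ (trans (sym (Vec.lookup-map i forget (word u))) eq)))
      (λ i j _ _ eq → forget≢1 (letter u j) (trans (sym (Vec.lookup-map j forget (word u))) eq)))

    forgetOnes-NoOnes : ∀ u → NoOnes (word (forgetOnes u))
    forgetOnes-NoOnes u i eq = forget≢1 (letter u i) (trans (sym (Vec.lookup-map i forget (word u))) eq)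

    forgetOnes-SameTwos : ∀ u → SameTwos (forgetOnes u) u
    forgetOnes-SameTwos u i =
      (λ eq → forget≡2⁻ (trans (sym (Vec.lookup-map i forget (word u))) eq)) ,
      (λ u≡2 → trans (Vec.lookup-map i forget (word u)) (cong forget u≡2))

    -- A triword in between has the same 2s. Beginning with 1 it must be `u`, otherwise it has no 1s
    -- and must be `forgetOnes u`.
    forgetOnes-⋖ : ∀ {u} → letter u zero ≡ 1F → forgetOnes u CLO.⋖ u
    forgetOnes-⋖ {u} u₀ = ((λ {c} → v⊑u {c}) , v≢u) , between
      where
      v = forgetOnes u

      v⊑u : v ⊑ u
      v⊑u {c} = NoOnes⇒⊑ {v} {u} (forgetOnes-NoOnes u) (proj₁ ∘ forgetOnes-SameTwos u) {c}

      v≢u : v ≢ u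
      v≢u eq = forgetOnes-NoOnes u zero (trans (cong (λ v → letter v zero) eq) u₀)

      between : ∀ z → ¬ (v CLO.< z × z CLO.< u)
      between z ((v⊑z , v≢z) , (z⊑u , z≢u)) = case letter z zero Fin.≟ 1F of λ
          { (yes z₀) → z≢u (1-head-≡ {z} {u} z₀ (λ {c} → z⊑u {c}) λ i →
            z⇒u i , v⇒z i ∘ proj₂ (forgetOnes-SameTwos u i))
          ; (no z₀)  → v≢z (NoOnes-≡ {v} {z} (forgetOnes-NoOnes u) (head≢1⇒NoOnes {z} z₀) λ i →
            v⇒z i , proj₂ (forgetOnes-SameTwos u i) ∘ z⇒u i)
          }
        where
        v⇒z = ⊑⇒two {m} {v} {z} (λ {c} → v⊑z {c})
        z⇒u = ⊑⇒two {m} {z} {u} (λ {c} → z⊑u {c})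

    replaceTwo : ∀ {u} → NoOnes (word u) → Fin (suc m) → Tri (suc m)
    replaceTwo {u} none i = tri (word u [ i ]≔ 0F)
      (replace-isTriword u i 0F (λ _ ()) (λ _ j _ → none j) (λ ()))

    replaceTwo-⋖ : ∀ {u i} (none : NoOnes (word u)) → letter u i ≡ 2F → replaceTwo {u} none i CLO.⋖ u
    replaceTwo-⋖ {u} {i} none u≡2 = remove-two-⋖ {u} {replaceTwo {u} none i} {i} none u≡2
      (Vec.lookup∘update i (word u) 0F) (λ j≢i → Vec.lookup∘update′ j≢i (word u) 0F)

    NoOnes-step : ∀ {u k} → NoOnes (word u) → ∣ twos (tail u) ∣ ≡ suc k →
                  ∃[ v ] (v CLO.⋖ u × NoOnes (word v) × ∣ twos (tail v) ∣ ≡ k)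
    NoOnes-step {u@(tri (a ∷ w) _)} none eq =
      let i , w≡2 , eq′ = ∣twos∣≡suc w eq
          v = replaceTwo {u} none (suc i)
          v⋖u = replaceTwo-⋖ {u} {suc i} none w≡2
      in v , v⋖u , 0-head-below {v} {u} (λ {c} → proj₁ (proj₁ v⋖u) {c}) none , eq′

    ∣twos∣≡0⇒⊥ : ∀ {u : Tri (suc m)} → NoOnes (word u) → ∣ twos (tail u) ∣ ≡ 0 → u ≡ ⊥ᵗ
    ∣twos∣≡0⇒⊥ {u@(tri (a ∷ w) _)} none eq = letter-injective λ where
      zero    → ≢1∧≢2⇒≡0 (none zero) (T2 u refl)
      (suc i) → trans (≢1∧≢2⇒≡0 (none (suc i)) (∣twos∣≡0 w eq i)) (sym (letter-⊥ {m} (suc i)))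

    twos-forgetOnes : ∀ u → twos (tail (forgetOnes u)) ≡ twos (tail u)
    twos-forgetOnes (tri (a ∷ w) _) = twos-forget w

    forgetOnes-head : ∀ {u} → letter u zero ≡ 1F → letter (forgetOnes u) zero ≡ 0F
    forgetOnes-head {tri (1F ∷ w) _} _ = refl

    module _ {rk : Tri (suc m) → ℕ} (isRank : IsRank (suc m) rk) where
      open CLO.IsRankFunction isRank

      -- A rank function is given only by its value at the bottom and its growth along covers, so
      -- the rank is read off from a chain of covers down to `⊥ᵗ` that deletes one 2 at a time. If
      -- the first letter is 1, the cover `forgetOnes-⋖` precedes this chain.
      rank-NoOnes : ∀ k {u} → NoOnes (word u) → ∣ twos (tail u) ∣ ≡ k → rk u ≡ k
      rank-NoOnes zero    {u} none eq = trans (cong rk (∣twos∣≡0⇒⊥ {u} none eq)) rk-bottom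
      rank-NoOnes (suc k) {u} none eq =
        let v , v⋖u , none-v , eq′ = NoOnes-step {u} none eq
        in trans (rk-cover {v} {u} v⋖u) (cong suc (rank-NoOnes k {v} none-v eq′))

      rank-0 : ∀ {u} → letter u zero ≡ 0F → rk u ≡ ∣ twos (tail u) ∣
      rank-0 {u} u₀ = rank-NoOnes _ {u} (0-head⇒NoOnes {m} {u} u₀) refl

      rank-1 : ∀ {u} → letter u zero ≡ 1F → rk u ≡ suc ∣ twos (tail u) ∣
      rank-1 {u} u₀ = trans (rk-cover {forgetOnes u} {u} (forgetOnes-⋖ {u} u₀))
        (cong suc (trans (rank-0 {forgetOnes u} (forgetOnes-head {u} u₀)) (cong ∣_∣ (twos-forgetOnes u))))

open Order

-- Finite sums and Möbius inversion

module Sums {c ℓ} (R : CommutativeRing c ℓ) where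
  open CommutativeRing R renaming (Carrier to K)
  open Triangles R
  open Algebra.Properties.Semiring.Mult semiring using (×-homo-+) renaming (_×_ to _×ᴷ_)
  open Algebra.Properties.Ring ring using (-0#≈0#; -‿+-comm)
  open Algebra.Properties.CommutativeSemigroup +-commutativeSemigroup using (interchange)
  open Relation.Binary.Reasoning.Setoid setoid

  ∑-cong : ∀ {A : Set} (xs : List A) {f g : A → K} → (∀ a → f a ≈ g a) → ∑ xs f ≈ ∑ xs g
  ∑-cong []       f≈g = refl
  ∑-cong (x ∷ xs) f≈g = +-cong (f≈g x) (∑-cong xs f≈g)

  ∑-cong-∈ : ∀ {A : Set} (xs : List A) {f g : A → K} → (∀ {a} → a ∈ xs → f a ≈ g a) → ∑ xs f ≈ ∑ xs g
  ∑-cong-∈ []       f≈g = refl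
  ∑-cong-∈ (x ∷ xs) f≈g = +-cong (f≈g (here ≡.refl)) (∑-cong-∈ xs (f≈g ∘ there))

  ∑-zero : ∀ {A : Set} (xs : List A) {f : A → K} → (∀ a → f a ≈ 0#) → ∑ xs f ≈ 0#
  ∑-zero []       f≈0 = refl
  ∑-zero (x ∷ xs) f≈0 = trans (+-cong (f≈0 x) (∑-zero xs f≈0)) (+-identityˡ 0#)

  ∑-map : ∀ {A B : Set} (h : A → B) xs {f : B → K} → ∑ (map h xs) f ≈ ∑ xs (f ∘ h)
  ∑-map h []       = refl
  ∑-map h (x ∷ xs) = +-congˡ (∑-map h xs)

  ∑-++ : ∀ {A : Set} (xs ys : List A) {f : A → K} → ∑ (xs ++ ys) f ≈ ∑ xs f + ∑ ys f
  ∑-++ []       ys = sym (+-identityˡ _)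
  ∑-++ (x ∷ xs) ys = trans (+-congˡ (∑-++ xs ys)) (sym (+-assoc _ _ _))

  ∑-+ : ∀ {A : Set} (xs : List A) {f g : A → K} → ∑ xs (λ a → f a + g a) ≈ ∑ xs f + ∑ xs g
  ∑-+ []       = sym (+-identityˡ 0#)
  ∑-+ (x ∷ xs) = trans (+-congˡ (∑-+ xs)) (interchange _ _ _ _)

  ∑-*ˡ : ∀ {A : Set} (xs : List A) {k : K} {f : A → K} → ∑ xs (λ a → k * f a) ≈ k * ∑ xs f
  ∑-*ˡ []       = sym (zeroʳ _)
  ∑-*ˡ (x ∷ xs) = trans (+-congˡ (∑-*ˡ xs)) (sym (distribˡ _ _ _))

  ∑-*ʳ : ∀ {A : Set} (xs : List A) {k : K} {f : A → K} → ∑ xs (λ a → f a * k) ≈ ∑ xs f * k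
  ∑-*ʳ xs = trans (∑-cong xs λ _ → *-comm _ _) (trans (∑-*ˡ xs) (*-comm _ _))

  ∑-swap : ∀ {A B : Set} (xs : List A) (ys : List B) {f : A → B → K} →
           ∑ xs (λ a → ∑ ys (f a)) ≈ ∑ ys (λ b → ∑ xs (λ a → f a b))
  ∑-swap []       ys = sym (∑-zero ys λ _ → refl)
  ∑-swap (x ∷ xs) ys = trans (+-congˡ (∑-swap xs ys)) (sym (∑-+ ys))

  ∑-mapMaybe : ∀ {A B : Set} (h : A → Maybe B) xs {f : B → K} →
               ∑ (mapMaybe h xs) f ≈ ∑ xs (maybe f 0# ∘ h)
  ∑-mapMaybe h []       = refl
  ∑-mapMaybe h (x ∷ xs) with h x
  ... | just _  = +-congˡ (∑-mapMaybe h xs)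
  ... | nothing = trans (∑-mapMaybe h xs) (sym (+-identityˡ _))

  -- Restricting a sum by zero summands leaves its list fixed, so that restricted sums can be
  -- exchanged and compared term by term.
  guard : {P : Set} → Dec P → K → K
  guard p? a = if does p? then a else 0#

  guard-yes : {P : Set} (p? : Dec P) {a : K} → P → guard p? a ≈ a
  guard-yes (yes _) p = refl
  guard-yes (no ¬p) p = contradiction p ¬p

  guard-no : {P : Set} (p? : Dec P) {a : K} → ¬ P → guard p? a ≈ 0#
  guard-no (yes p) ¬p = contradiction p ¬p
  guard-no (no _)  ¬p = refl

  guard-⇔ : {P Q : Set} (p? : Dec P) (q? : Dec Q) {a b : K} → (P → Q) → (Q → P) → (P → a ≈ b) →
            guard p? a ≈ guard q? b
  guard-⇔ (yes p) q? to from a≈b = trans (a≈b p) (sym (guard-yes q? (to p)))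
  guard-⇔ (no ¬p) q? to from a≈b = sym (guard-no q? (¬p ∘ from))

  guard-cong : {P : Set} (p? : Dec P) {a b : K} → a ≈ b → guard p? a ≈ guard p? b
  guard-cong p? a≈b = guard-⇔ p? p? (λ p → p) (λ p → p) (λ _ → a≈b)

  guard-+ : {P : Set} (p? : Dec P) {a b : K} → guard p? (a + b) ≈ guard p? a + guard p? b
  guard-+ (yes _) = refl
  guard-+ (no _)  = sym (+-identityˡ 0#)

  guard-*ˡ : {P : Set} (p? : Dec P) {k a : K} → guard p? (k * a) ≈ k * guard p? a
  guard-*ˡ (yes _) = refl
  guard-*ˡ (no _)  = sym (zeroʳ _)

  guard-*ʳ : {P : Set} (p? : Dec P) {k a : K} → guard p? (a * k) ≈ guard p? a * k
  guard-*ʳ (yes _) = refl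
  guard-*ʳ (no _)  = sym (zeroˡ _)

  guard-× : {P : Set} (p? : Dec P) (n : ℕ) {a : K} → n ×ᴷ guard p? a ≈ guard p? (n ×ᴷ a)
  guard-× (yes _) n       = refl
  guard-× (no _)  zero    = refl
  guard-× (no ¬p) (suc n) {a} = trans (+-identityˡ _) (guard-× (no ¬p) n {a})

  ∑-filter : ∀ {A : Set} {P : A → Set} (P? : Unary.Decidable P) xs {f : A → K} →
             ∑ (filter P? xs) f ≈ ∑ xs (λ a → guard (P? a) (f a))
  ∑-filter P? []       = refl
  ∑-filter P? (x ∷ xs) with does (P? x)
  ... | true  = +-congˡ (∑-filter P? xs)
  ... | false = trans (∑-filter P? xs) (sym (+-identityˡ _))

  fromℤ-⊖ : ∀ m n → fromℤ (m ℤ.⊖ n) ≈ m ×ᴷ 1# - n ×ᴷ 1#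
  fromℤ-⊖ zero    zero    = sym (trans (+-identityˡ _) -0#≈0#)
  fromℤ-⊖ (suc m) zero    = sym (trans (+-congˡ -0#≈0#) (+-identityʳ _))
  fromℤ-⊖ zero    (suc n) = sym (+-identityˡ _)
  fromℤ-⊖ (suc m) (suc n) = begin
    fromℤ (suc m ℤ.⊖ suc n)                    ≡⟨ ≡.cong fromℤ (ℤ.[1+m]⊖[1+n]≡m⊖n m n) ⟩
    fromℤ (m ℤ.⊖ n)                            ≈⟨ fromℤ-⊖ m n ⟩
    m ×ᴷ 1# - n ×ᴷ 1#                          ≈⟨ +-identityˡ _ ⟨
    0# + (m ×ᴷ 1# - n ×ᴷ 1#)                   ≈⟨ +-congʳ (-‿inverseʳ 1#) ⟨
    (1# - 1#) + (m ×ᴷ 1# - n ×ᴷ 1#)            ≈⟨ interchange _ _ _ _ ⟩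
    suc m ×ᴷ 1# + (- 1# + - (n ×ᴷ 1#))         ≈⟨ +-congˡ (-‿+-comm _ _) ⟩
    suc m ×ᴷ 1# - suc n ×ᴷ 1#                  ∎

  fromℤ-+ : ∀ i j → fromℤ (i ℤ.+ j) ≈ fromℤ i + fromℤ j
  fromℤ-+ (ℤ.+ m)    (ℤ.+ n)    = ×-homo-+ 1# m n
  fromℤ-+ (ℤ.+ m)    ℤ.-[1+ n ] = fromℤ-⊖ m (suc n)
  fromℤ-+ ℤ.-[1+ m ] (ℤ.+ n)    = trans (fromℤ-⊖ n (suc m)) (+-comm _ _)
  fromℤ-+ ℤ.-[1+ m ] ℤ.-[1+ n ] = trans
    (-‿cong (trans (reflexive (≡.cong (_×ᴷ 1#) (≡.cong suc (≡.sym (ℕ.+-suc m n)))))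
          (×-homo-+ 1# (suc m) (suc n))))
    (sym (-‿+-comm _ _))

  fromℤ-sum : ∀ {A : Set} (xs : List A) {f : A → ℤ} → fromℤ (sumℤ (map f xs)) ≈ ∑ xs (fromℤ ∘ f)
  fromℤ-sum []           = refl
  fromℤ-sum (x ∷ xs) {f} = trans (fromℤ-+ (f x) (sumℤ (map f xs))) (+-congˡ (fromℤ-sum xs {f}))

  module Inversion {A : Set} (finite : Finite A) {_≤_ : Rel A 0ℓ} (_≤?_ : Decidable _≤_)
                   (≤-refl : Reflexive _≤_) (≤-trans : Transitive _≤_)
                   (≤-antisym : ∀ {a b} → a ≤ b → b ≤ a → a ≡ b)
                   {μ : A → A → ℤ} (isMöbius : FiniteOrder.IsMöbiusFunction finite _≤?_ μ) where
    open Finite finite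
    open FiniteOrder finite _≤?_
    open IsMöbiusFunction isMöbius

    ∑-δ : ∀ a {k} → ∑ elements (λ b → guard (a ≟ b) k) ≈ k
    ∑-δ a {k} = go unique (complete a)
      where
      δ-zero : ∀ {bs} → All.All (a ≢_) bs → ∑ bs (λ b → guard (a ≟ b) k) ≈ 0#
      δ-zero All.[]         = refl
      δ-zero (a≢b All.∷ a∉) = trans (+-cong (guard-no (a ≟ _) a≢b) (δ-zero a∉)) (+-identityˡ 0#)

      go : ∀ {bs} → Unique bs → a ∈ bs → ∑ bs (λ b → guard (a ≟ b) k) ≈ k
      go (a∉ ∷ _) (here ≡.refl) =
        trans (+-cong (guard-yes (a ≟ a) ≡.refl) (δ-zero a∉)) (+-identityʳ k)
      go (b∉ ∷ bs!) (there a∈) =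
        trans (+-cong (guard-no (a ≟ _) λ { ≡.refl → All.lookup b∉ a∈ ≡.refl }) (go bs! a∈)) (+-identityˡ k)

    -- For a strictly below c, the recursion for `μ` is the sum over `a ≤ b < c`, and the term
    -- `b = c` cancels it. The condition `a ≤ b` can be left out since `μ` vanishes outside the
    -- order.
    μ-sum : ∀ a c → ∑ elements (λ b → guard (b ≤? c) (fromℤ (μ a b))) ≈ guard (a ≟ c) 1#
    μ-sum a c with a ≟ c
    ... | yes ≡.refl = trans (∑-cong elements term) (∑-δ a)
      where
      term : ∀ b → guard (b ≤? a) (fromℤ (μ a b)) ≈ guard (a ≟ b) 1#
      term b with a ≟ b
      ... | yes ≡.refl = trans (guard-yes (a ≤? a) ≤-refl)
                           (trans (reflexive (≡.cong fromℤ (μ-refl a))) (+-identityʳ 1#))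
      ... | no a≢b with b ≤? a
      ...   | no _    = refl
      ...   | yes b≤a = reflexive (≡.cong fromℤ (μ-outside λ a≤b → a≢b (≤-antisym a≤b b≤a)))
    ... | no a≢c with a ≤? c
    ...   | no a≰c = ∑-zero elements term
      where
      term : ∀ b → guard (b ≤? c) (fromℤ (μ a b)) ≈ 0#
      term b with b ≤? c
      ... | no _    = refl
      ... | yes b≤c = reflexive (≡.cong fromℤ (μ-outside λ a≤b → a≰c (≤-trans a≤b b≤c)))
    ...   | yes a≤c = begin
      ∑ elements (λ b → guard (b ≤? c) (fromℤ (μ a b)))
        ≈⟨ ∑-cong elements term ⟩
      ∑ elements (λ b → guard (between? b) (fromℤ (μ a b)) + guard (c ≟ b) (fromℤ (μ a c)))
        ≈⟨ ∑-+ elements ⟩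
      ∑ elements (λ b → guard (between? b) (fromℤ (μ a b))) + ∑ elements (λ b → guard (c ≟ b) (fromℤ (μ a c)))
        ≈⟨ +-cong (sym (∑-filter between? elements)) (∑-δ c) ⟩
      ∑ (filter between? elements) (fromℤ ∘ μ a) + fromℤ (μ a c)
        ≈⟨ +-cong (sym (fromℤ-sum (filter between? elements))) (reflexive (≡.cong fromℤ (μ-rec (a≤c , a≢c)))) ⟩
      fromℤ s + fromℤ (ℤ.- s)
        ≈⟨ fromℤ-+ s (ℤ.- s) ⟨
      fromℤ (s ℤ.+ ℤ.- s)
        ≡⟨ ≡.cong fromℤ (ℤ.+-inverseʳ s) ⟩
      0# ∎
      where
      between? : Unary.Decidable (λ b → a ≤ b × b < c)
      between? b = (a ≤? b) ×-dec (b <? c)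
      s = sumℤ (map (μ a) (filter between? elements))

      term : ∀ b → guard (b ≤? c) (fromℤ (μ a b)) ≈
             guard (between? b) (fromℤ (μ a b)) + guard (c ≟ b) (fromℤ (μ a c))
      term b with c ≟ b
      ... | yes ≡.refl = trans (guard-yes (c ≤? c) ≤-refl)
        (sym (trans (+-congʳ (guard-no (between? c) λ (_ , _ , c≢c) → c≢c ≡.refl)) (+-identityˡ _)))
      ... | no c≢b = trans term′ (sym (+-identityʳ _))
        where
        term′ : guard (b ≤? c) (fromℤ (μ a b)) ≈ guard (between? b) (fromℤ (μ a b))
        term′ with a ≤? b
        ... | yes a≤b = guard-⇔ (b ≤? c) (yes a≤b ×-dec (b <? c))
          (λ b≤c → a≤b , b≤c , c≢b ∘ ≡.sym) (λ (_ , b≤c , _) → b≤c) (λ _ → refl)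
        ... | no a≰b with b ≤? c
        ...   | no _  = refl
        ...   | yes _ = reflexive (≡.cong fromℤ (μ-outside a≰b))

    -- With `g` expanded into upper sums of `f`, exchanging the sums leaves the kernel of `μ-sum`, a
    -- delta. So a guessed `f` only has to be checked against its upper sums.
    inversion : (f g : A → K) → (∀ b → ∑ elements (λ c → guard (b ≤? c) (f c)) ≈ g b) →
                ∀ a → ∑ elements (λ b → fromℤ (μ a b) * g b) ≈ f a
    inversion f g f↑≈g a = begin
      ∑ elements (λ b → fromℤ (μ a b) * g b)
        ≈⟨ ∑-cong elements (λ b → trans (*-congˡ (sym (f↑≈g b))) (sym (∑-*ˡ elements))) ⟩
      ∑ elements (λ b → ∑ elements (λ c → fromℤ (μ a b) * guard (b ≤? c) (f c)))
        ≈⟨ ∑-swap elements elements ⟩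
      ∑ elements (λ c → ∑ elements (λ b → fromℤ (μ a b) * guard (b ≤? c) (f c)))
        ≈⟨ ∑-cong elements (λ c → trans (∑-cong elements λ b →
             trans (sym (guard-*ˡ (b ≤? c))) (guard-*ʳ (b ≤? c))) (∑-*ʳ elements)) ⟩
      ∑ elements (λ c → ∑ elements (λ b → guard (b ≤? c) (fromℤ (μ a b))) * f c)
        ≈⟨ ∑-cong elements (λ c → trans (*-congʳ (μ-sum a c))
             (trans (sym (guard-*ʳ (a ≟ c))) (guard-⇔ (a ≟ c) (a ≟ c) (λ p → p) (λ p → p)
               λ { ≡.refl → *-identityˡ (f c) }))) ⟩
      ∑ elements (λ c → guard (a ≟ c) (f a))
        ≈⟨ ∑-δ a ⟩
      f a ∎

-- Sums over triwords, grouped by their set of 2s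

-- Condition (T3) alone, for tails: (T2) concerns only the first letter.
Ordered : ∀ {m} → Vec (Fin 3) m → Set
Ordered w = ∀ i j → i Fin.< j → lookup w i ≡ 0F → lookup w j ≢ 1F

noOnes? : ∀ {m} (w : Vec (Fin 3) m) → Dec (NoOnes w)
noOnes? w = Fin.all? λ j → ¬? (lookup w j Fin.≟ 1F)

ordered? : ∀ {m} (w : Vec (Fin 3) m) → Dec (Ordered w)
ordered? w = Fin.all? λ i → Fin.all? λ j →
  (i Fin.<? j) →-dec (lookup w i Fin.≟ 0F) →-dec ¬? (lookup w j Fin.≟ 1F)

NoOnes-∷⁺ : ∀ {m a} {w : Vec (Fin 3) m} → a ≢ 1F → NoOnes w → NoOnes (a ∷ w)
NoOnes-∷⁺ a≢1 none zero    = a≢1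
NoOnes-∷⁺ a≢1 none (suc j) = none j

Ordered-tail : ∀ {m a} {w : Vec (Fin 3) m} → Ordered (a ∷ w) → Ordered w
Ordered-tail ord i j i<j = ord (suc i) (suc j) (s≤s i<j)

Ordered-∷⁺ : ∀ {m a} {w : Vec (Fin 3) m} → a ≢ 0F → Ordered w → Ordered (a ∷ w)
Ordered-∷⁺ a≢0 ord zero    j       _         a≡0 = contradiction a≡0 a≢0
Ordered-∷⁺ a≢0 ord (suc i) (suc j) (s≤s i<j) = ord i j i<j

Ordered-0∷⁻ : ∀ {m} {w : Vec (Fin 3) m} → Ordered (0F ∷ w) → NoOnes w
Ordered-0∷⁻ ord j = ord zero (suc j) (s≤s z≤n) ≡.refl

Ordered-0∷⁺ : ∀ {m} {w : Vec (Fin 3) m} → NoOnes w → Ordered (0F ∷ w)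
Ordered-0∷⁺ none i (suc j) _ _ = none j

-- The core label order on tails once both first letters are 1: letters are kept or become 2.
Above : ∀ {m} → Vec (Fin 3) m → Vec (Fin 3) m → Set
Above w w′ = ∀ i → lookup w′ i ≡ lookup w i ⊎ lookup w′ i ≡ 2F

above? : ∀ {m} (w w′ : Vec (Fin 3) m) → Dec (Above w w′)
above? w w′ = Fin.all? λ i → (lookup w′ i Fin.≟ lookup w i) ⊎-dec (lookup w′ i Fin.≟ 2F)

Above-∷⁺ : ∀ {m a b} {w w′ : Vec (Fin 3) m} → b ≡ a ⊎ b ≡ 2F → Above w w′ → Above (a ∷ w) (b ∷ w′)
Above-∷⁺ ba above zero    = ba
Above-∷⁺ ba above (suc i) = above i

module WordSums {c ℓ} (R : CommutativeRing c ℓ) where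
  open CommutativeRing R hiding (zero) renaming (Carrier to K)
  open Triangles R
  open Sums R
  open Algebra.Properties.Semiring.Mult semiring using () renaming (_×_ to _×ᴷ_)
  open Algebra.Properties.CommutativeMonoid.Mult +-commutativeMonoid using (×-congʳ)
  open Algebra.Properties.CommutativeSemigroup +-commutativeSemigroup using (interchange)
  open Algebra.Solver.Ring.NaturalCoefficients.Default commutativeSemiring using (solve; _:=_; _:+_; _:*_; con)
  open Relation.Binary.Reasoning.Setoid setoid

  ∑-words : ∀ m {h : Vec (Fin 3) (suc m) → K} → ∑ (words (suc m)) h ≈
            ∑ (words m) (h ∘ (0F ∷_)) + (∑ (words m) (h ∘ (1F ∷_)) + ∑ (words m) (h ∘ (2F ∷_)))
  ∑-words m {h} = trans (∑-++ (map (0F ∷_) (words m)) _) (+-cong (∑-map (0F ∷_) (words m))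
    (trans (∑-++ (map (1F ∷_) (words m)) _) (+-cong (∑-map (1F ∷_) (words m))
      (trans (∑-++ (map (2F ∷_) (words m)) _) (trans (+-identityʳ _) (∑-map (2F ∷_) (words m)))))))

  -- Recursion on `m` rather than a list of subsets, in step with the splitting of `words` by first
  -- letter: 0 and 1 are `outside`, 2 is `inside`.
  ∑ˢ : ∀ m → (Subset m → K) → K
  ∑ˢ zero    h = h []
  ∑ˢ (suc m) h = ∑ˢ m (h ∘ (outside ∷_)) + ∑ˢ m (h ∘ (inside ∷_))

  ∑ˢ-cong : ∀ m {g h : Subset m → K} → (∀ T → g T ≈ h T) → ∑ˢ m g ≈ ∑ˢ m h
  ∑ˢ-cong zero    g≈h = g≈h []
  ∑ˢ-cong (suc m) g≈h = +-cong (∑ˢ-cong m (g≈h ∘ (outside ∷_))) (∑ˢ-cong m (g≈h ∘ (inside ∷_)))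

  ∑ˢ-+ : ∀ m {g h : Subset m → K} → ∑ˢ m (λ T → g T + h T) ≈ ∑ˢ m g + ∑ˢ m h
  ∑ˢ-+ zero    = refl
  ∑ˢ-+ (suc m) = trans (+-cong (∑ˢ-+ m) (∑ˢ-+ m)) (interchange _ _ _ _)

  ∑ˢ-*ˡ : ∀ m {k} {h : Subset m → K} → ∑ˢ m (λ T → k * h T) ≈ k * ∑ˢ m h
  ∑ˢ-*ˡ zero    = refl
  ∑ˢ-*ˡ (suc m) = trans (+-cong (∑ˢ-*ˡ m) (∑ˢ-*ˡ m)) (sym (distribˡ _ _ _))

  ∑ˢ-zero : ∀ m {h : Subset m → K} → (∀ T → h T ≈ 0#) → ∑ˢ m h ≈ 0#
  ∑ˢ-zero zero    h≈0 = h≈0 []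
  ∑ˢ-zero (suc m) h≈0 =
    trans (+-cong (∑ˢ-zero m (h≈0 ∘ (outside ∷_))) (∑ˢ-zero m (h≈0 ∘ (inside ∷_)))) (+-identityˡ 0#)

  ∑-noOnes : ∀ m {h : Subset m → K} → ∑ (words m) (λ w → guard (noOnes? w) (h (twos w))) ≈ ∑ˢ m h
  ∑-noOnes zero            = +-identityʳ _
  ∑-noOnes (suc m) {h} = trans (∑-words m) (+-cong
    (trans (∑-cong (words m) λ w → guard-⇔ (noOnes? (0F ∷ w)) (noOnes? w) (_∘ suc) (NoOnes-∷⁺ λ ()) λ _ → refl)
           (∑-noOnes m))
    (trans (+-cong
      (∑-zero (words m) λ w → guard-no (noOnes? (1F ∷ w)) {0#} λ none → none zero ≡.refl)
      (trans (∑-cong (words m) λ w → guard-⇔ (noOnes? (2F ∷ w)) (noOnes? w) (_∘ suc) (NoOnes-∷⁺ λ ()) λ _ → refl)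
             (∑-noOnes m)))
      (+-identityˡ _)))

  -- Among the tails of triwords with u₁ = 1 and a given set T of 2s, one has no 1, and each position
  -- outside T is the position of the last 1 in exactly one of the others.
  ∑-ordered : ∀ m {h : Bool → Subset m → K} →
    ∑ (words m) (λ w → guard (ordered? w) (h (does (noOnes? w)) (twos w))) ≈
    ∑ˢ m (λ T → h true T + ∣ ∁ T ∣ ×ᴷ h false T)
  ∑-ordered zero            = trans (+-identityʳ _) (sym (+-identityʳ _))
  ∑-ordered (suc m) {h} = begin
    ∑ (words (suc m)) (λ w → guard (ordered? w) (h (does (noOnes? w)) (twos w)))
      ≈⟨ ∑-words m ⟩
    ∑ (words m) _ + (∑ (words m) _ + ∑ (words m) _)
      ≈⟨ +-cong (trans (∑-cong (words m) zero-term) (∑-noOnes m {h₀}))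
                -- After a leading 1 the flag is false whatever follows, so induction is used with a
                -- constant first argument. The `1 + ∣ ∁ T ∣` copies of `h₁ T` are the
                -- `∣ ∁ (outside ∷ T) ∣` copies required; the leading 0 supplies the term with
                -- `true`.
                (+-cong (trans (∑-cong (words m) one-term) (∑-ordered m {λ _ → h₁}))
                        (trans (∑-cong (words m) two-term) (∑-ordered m {λ b → h b ∘ (inside ∷_)}))) ⟩
    ∑ˢ m h₀ + (∑ˢ m (λ T → h₁ T + ∣ ∁ T ∣ ×ᴷ h₁ T) +
      ∑ˢ m (λ T → h true (inside ∷ T) + ∣ ∁ T ∣ ×ᴷ h false (inside ∷ T)))
      ≈⟨ +-assoc _ _ _ ⟨
    (∑ˢ m h₀ + ∑ˢ m (λ T → h₁ T + ∣ ∁ T ∣ ×ᴷ h₁ T)) +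
      ∑ˢ m (λ T → h true (inside ∷ T) + ∣ ∁ T ∣ ×ᴷ h false (inside ∷ T))
      ≈⟨ +-congʳ (∑ˢ-+ m) ⟨
    ∑ˢ (suc m) (λ T → h true T + ∣ ∁ T ∣ ×ᴷ h false T) ∎
    where
    h₀ h₁ : Subset m → K
    h₀ T = h true (outside ∷ T)
    h₁ T = h false (outside ∷ T)

    zero-term : ∀ w → guard (ordered? (0F ∷ w)) (h (does (noOnes? (0F ∷ w))) (outside ∷ twos w)) ≈
                      guard (noOnes? w) (h₀ (twos w))
    zero-term w = guard-⇔ (ordered? (0F ∷ w)) (noOnes? w) Ordered-0∷⁻ Ordered-0∷⁺ λ ord →
      reflexive (≡.cong (λ b → h b (outside ∷ twos w))
        (dec-true (noOnes? (0F ∷ w)) (NoOnes-∷⁺ (λ ()) (Ordered-0∷⁻ ord))))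

    one-term : ∀ w → guard (ordered? (1F ∷ w)) (h (does (noOnes? (1F ∷ w))) (outside ∷ twos w)) ≈
                     guard (ordered? w) (h₁ (twos w))
    one-term w = guard-⇔ (ordered? (1F ∷ w)) (ordered? w) Ordered-tail (Ordered-∷⁺ λ ()) λ _ →
      reflexive (≡.cong (λ b → h b (outside ∷ twos w)) (dec-false (noOnes? (1F ∷ w)) λ none → none zero ≡.refl))

    two-term : ∀ w → guard (ordered? (2F ∷ w)) (h (does (noOnes? (2F ∷ w))) (inside ∷ twos w)) ≈
                     guard (ordered? w) (h (does (noOnes? w)) (inside ∷ twos w))
    two-term w = guard-⇔ (ordered? (2F ∷ w)) (ordered? w) Ordered-tail (Ordered-∷⁺ λ ()) λ _ →
      reflexive (≡.cong (λ b → h b (inside ∷ twos w))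
        (does-⇔ (mk⇔ (_∘ suc) (NoOnes-∷⁺ λ ())) (noOnes? (2F ∷ w)) (noOnes? w)))

  maybe-toTri : ∀ {n} {G : Tri n → K} w {k} → (∀ p → G (tri w p) ≈ k) → (¬ IsTriword w → 0# ≈ k) →
                maybe G 0# (toTri w) ≈ k
  maybe-toTri w yes-case no-case with isTriword? w
  ... | yes p = yes-case p
  ... | no ¬p = no-case ¬p

  ∑-triwords-head : ∀ m {G : Tri (suc m) → K} → ∑ (triwords (suc m)) G ≈
    ∑ (words m) (λ w → maybe G 0# (toTri (0F ∷ w))) + ∑ (words m) (λ w → maybe G 0# (toTri (1F ∷ w)))
  ∑-triwords-head m {G} = trans (∑-mapMaybe toTri (words (suc m))) (trans (∑-words m) (+-congˡ
    (trans (+-congˡ (∑-zero (words m) λ w → maybe-toTri {G = G} (2F ∷ w)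
             (λ p → contradiction ≡.refl (IsTriword.T2 p zero ≡.refl)) (λ _ → refl)))
           (+-identityʳ _))))

  -- Serves both sides of the identity and the upper sums at u₁ = 0, where summands see only the
  -- first letter, the 2s and whether the tail has a 1. The upper sums at u₁ = 1 depend on where the
  -- 1s are and use `∑-triwords-head` directly.
  ∑-triwords : ∀ m {G : Tri (suc m) → K} {g₀ : Subset m → K} {g₁ : Bool → Subset m → K} →
    (∀ u → letter u zero ≡ 0F → G u ≈ g₀ (twos (tail u))) →
    (∀ u → letter u zero ≡ 1F → G u ≈ g₁ (does (noOnes? (tail u))) (twos (tail u))) →
    ∑ (triwords (suc m)) G ≈ ∑ˢ m (λ T → g₀ T + (g₁ true T + ∣ ∁ T ∣ ×ᴷ g₁ false T))
  ∑-triwords m {G} {g₀} {g₁} G≈g₀ G≈g₁ = begin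
    ∑ (triwords (suc m)) G
      ≈⟨ ∑-triwords-head m ⟩
    ∑ (words m) _ + ∑ (words m) _
      ≈⟨ +-cong (trans (∑-cong (words m) λ w → maybe-toTri (0F ∷ w)
                   (λ p → trans (G≈g₀ (tri (0F ∷ w) p) ≡.refl)
                     (sym (guard-yes (noOnes? w) (Ordered-0∷⁻ (IsTriword.T3 p)))))
                   (λ ¬p → sym (guard-no (noOnes? w) λ none → ¬p (mkIsTriword T2-0 (Ordered-0∷⁺ none)))))
                 (∑-noOnes m {g₀}))
                (trans (∑-cong (words m) λ w → maybe-toTri (1F ∷ w)
                   (λ p → trans (G≈g₁ (tri (1F ∷ w) p) ≡.refl)
                     (sym (guard-yes (ordered? w) (Ordered-tail (IsTriword.T3 p)))))
                   (λ ¬p → sym (guard-no (ordered? w) λ ord → ¬p (mkIsTriword T2-1 (Ordered-∷⁺ (λ ()) ord)))))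
                 (∑-ordered m {g₁})) ⟩
    ∑ˢ m g₀ + ∑ˢ m (λ T → g₁ true T + ∣ ∁ T ∣ ×ᴷ g₁ false T)
      ≈⟨ ∑ˢ-+ m ⟨
    ∑ˢ m (λ T → g₀ T + (g₁ true T + ∣ ∁ T ∣ ×ᴷ g₁ false T)) ∎
    where
    T2-0 : ∀ {w : Vec (Fin 3) m} i → toℕ i ≡ 0 → lookup (0F ∷ w) i ≢ 2F
    T2-0 zero _ ()
    T2-1 : ∀ {w : Vec (Fin 3) m} i → toℕ i ≡ 0 → lookup (1F ∷ w) i ≢ 2F
    T2-1 zero _ ()

  -- Binomial weights on sets of positions

  module _ {Y Z : K} (Y+Z≈1 : Y + Z ≈ 1#) where

    -- Formally the probability of `T` when each position is chosen independently with probability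
    -- `Y`; a position without constraint sums out to `Z + Y`, which is 1.
    weight : ∀ {m} → Subset m → K
    weight T = Y ^ ∣ T ∣ * Z ^ ∣ ∁ T ∣

    weight-out : ∀ {m} (T : Subset m) → weight (outside ∷ T) ≈ Z * weight T
    weight-out T = x∙yz≈y∙xz _ _ _
      where open Algebra.Properties.CommutativeSemigroup *-commutativeSemigroup using (x∙yz≈y∙xz)

    weight-in : ∀ {m} (T : Subset m) → weight (inside ∷ T) ≈ Y * weight T
    weight-in T = *-assoc _ _ _

    Z+Y-split : ∀ k → Z * k + Y * k ≈ k
    Z+Y-split k = trans (sym (distribʳ k Z Y)) (trans (*-congʳ (trans (+-comm Z Y) Y+Z≈1)) (*-identityˡ k))

    ∑ˢ-weight : ∀ {m} (S : Subset m) → ∑ˢ m (λ T → guard (S ⊆? T) (weight T)) ≈ Y ^ ∣ S ∣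
    ∑ˢ-weight []            = *-identityˡ 1#
    ∑ˢ-weight {suc m} (outside ∷ S) = begin
      ∑ˢ m (λ T → guard ((outside ∷ S) ⊆? (outside ∷ T)) (weight (outside ∷ T))) +
      ∑ˢ m (λ T → guard ((outside ∷ S) ⊆? (inside ∷ T)) (weight (inside ∷ T)))
        ≈⟨ +-cong
             (∑ˢ-cong m λ T → trans (guard-⇔ ((outside ∷ S) ⊆? (outside ∷ T)) (S ⊆? T)
               Subset.drop-∷-⊆ Subset.out⊆ (λ _ → weight-out T)) (guard-*ˡ (S ⊆? T)))
             (∑ˢ-cong m λ T → trans (guard-⇔ ((outside ∷ S) ⊆? (inside ∷ T)) (S ⊆? T)
               Subset.drop-∷-⊆ Subset.out⊆ (λ _ → weight-in T)) (guard-*ˡ (S ⊆? T))) ⟩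
      ∑ˢ m (λ T → Z * guard (S ⊆? T) (weight T)) + ∑ˢ m (λ T → Y * guard (S ⊆? T) (weight T))
        ≈⟨ +-cong (∑ˢ-*ˡ m) (∑ˢ-*ˡ m) ⟩
      Z * ∑ˢ m (λ T → guard (S ⊆? T) (weight T)) + Y * ∑ˢ m (λ T → guard (S ⊆? T) (weight T))
        ≈⟨ Z+Y-split _ ⟩
      ∑ˢ m (λ T → guard (S ⊆? T) (weight T))
        ≈⟨ ∑ˢ-weight S ⟩
      Y ^ ∣ S ∣ ∎
    ∑ˢ-weight {suc m} (inside ∷ S) = begin
      ∑ˢ m (λ T → guard ((inside ∷ S) ⊆? (outside ∷ T)) (weight (outside ∷ T))) +
      ∑ˢ m (λ T → guard ((inside ∷ S) ⊆? (inside ∷ T)) (weight (inside ∷ T)))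
        ≈⟨ +-cong
             (∑ˢ-zero m λ T → guard-no ((inside ∷ S) ⊆? (outside ∷ T)) {0#} λ S⊆T → case S⊆T here of λ ())
             (∑ˢ-cong m λ T → trans (guard-⇔ ((inside ∷ S) ⊆? (inside ∷ T)) (S ⊆? T)
               Subset.drop-∷-⊆ Subset.in⊆in (λ _ → weight-in T)) (guard-*ˡ (S ⊆? T))) ⟩
      0# + ∑ˢ m (λ T → Y * guard (S ⊆? T) (weight T))
        ≈⟨ trans (+-identityˡ _) (∑ˢ-*ˡ m) ⟩
      Y * ∑ˢ m (λ T → guard (S ⊆? T) (weight T))
        ≈⟨ *-congˡ (∑ˢ-weight S) ⟩
      Y * Y ^ ∣ S ∣ ∎

    -- A 2 must stay and contributes `Y`; a 0 or 1 either stays, with `Z`, or becomes 2, with `Y`,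
    -- and so contributes 1 in total.
    ∑-above : ∀ {m} (w : Vec (Fin 3) m) →
              ∑ (words m) (λ w′ → guard (above? w w′) (weight (twos w′))) ≈ Y ^ ∣ twos w ∣
    ∑-above []      = trans (+-identityʳ _) (*-identityˡ 1#)
    ∑-above {suc m} (a ∷ w) = trans (∑-words m) (by-letter a)
      where
      s : K
      s = ∑ (words m) (λ w′ → guard (above? w w′) (weight (twos w′)))

      term : Fin 3 → Fin 3 → K
      term a b = ∑ (words m) (λ w′ → guard (above? (a ∷ w) (b ∷ w′)) (weight (twos (b ∷ w′))))

      vanish : ∀ a b → b ≢ a → b ≢ 2F → term a b ≈ 0#
      vanish a b b≢a b≢2 = ∑-zero (words m) λ w′ →
        guard-no (above? (a ∷ w) (b ∷ w′)) λ above → [ b≢a , b≢2 ]′ (above zero)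

      match : ∀ a b k → b ≡ a ⊎ b ≡ 2F →
              (∀ w′ → weight (twos (b ∷ w′)) ≈ k * weight (twos w′)) → term a b ≈ k * s
      match a b k ba eq = trans (∑-cong (words m) λ w′ →
        trans (guard-⇔ (above? (a ∷ w) (b ∷ w′)) (above? w w′) (_∘ suc) (Above-∷⁺ ba) (λ _ → eq w′))
              (guard-*ˡ (above? w w′))) (∑-*ˡ (words m))

      by-letter : ∀ a → term a 0F + (term a 1F + term a 2F) ≈ Y ^ ∣ twos (a ∷ w) ∣
      by-letter 0F = begin
        term 0F 0F + (term 0F 1F + term 0F 2F)
          ≈⟨ +-cong (match 0F 0F Z (inj₁ ≡.refl) (weight-out ∘ twos))
               (trans (+-cong (vanish 0F 1F (λ ()) (λ ()))
                 (match 0F 2F Y (inj₂ ≡.refl) (weight-in ∘ twos))) (+-identityˡ _)) ⟩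
        Z * s + Y * s ≈⟨ Z+Y-split s ⟩
        s             ≈⟨ ∑-above w ⟩
        Y ^ ∣ twos w ∣ ∎
      by-letter 1F = begin
        term 1F 0F + (term 1F 1F + term 1F 2F)
          ≈⟨ trans (+-congʳ (vanish 1F 0F (λ ()) (λ ()))) (+-identityˡ _) ⟩
        term 1F 1F + term 1F 2F
          ≈⟨ +-cong (match 1F 1F Z (inj₁ ≡.refl) (weight-out ∘ twos))
                    (match 1F 2F Y (inj₂ ≡.refl) (weight-in ∘ twos)) ⟩
        Z * s + Y * s ≈⟨ Z+Y-split s ⟩
        s             ≈⟨ ∑-above w ⟩
        Y ^ ∣ twos w ∣ ∎
      by-letter 2F = begin
        term 2F 0F + (term 2F 1F + term 2F 2F)
          ≈⟨ +-cong (vanish 2F 0F (λ ()) (λ ()))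
               (+-cong (vanish 2F 1F (λ ()) (λ ())) (match 2F 2F Y (inj₁ ≡.refl) (weight-in ∘ twos))) ⟩
        0# + (0# + Y * s) ≈⟨ trans (+-identityˡ _) (+-identityˡ _) ⟩
        Y * s             ≈⟨ *-congˡ (∑-above w) ⟩
        Y * Y ^ ∣ twos w ∣ ∎

  -- Generating functions of subsets of a list

  module _ {A : Set} {P : A → Set} (P? : Unary.Decidable P) (x y : K) where
    private
      #⁺ #⁻ : List A → ℕ
      #⁺ = length ∘ filter P?
      #⁻ = length ∘ filter (¬? ∘ P?)

      #⁺-accept : ∀ {z} → P z → ∀ zs → #⁺ (z ∷ zs) ≡ suc (#⁺ zs)
      #⁺-accept p zs = ≡.cong length (List.filter-accept P? p)
      #⁻-accept : ∀ {z} → ¬ P z → ∀ zs → #⁻ (z ∷ zs) ≡ suc (#⁻ zs)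
      #⁻-accept ¬p zs = ≡.cong length (List.filter-accept (¬? ∘ P?) ¬p)
      #⁺-reject : ∀ {z} → ¬ P z → ∀ zs → #⁺ (z ∷ zs) ≡ #⁺ zs
      #⁺-reject ¬p zs = ≡.cong length (List.filter-reject P? ¬p)
      #⁻-reject : ∀ {z} → P z → ∀ zs → #⁻ (z ∷ zs) ≡ #⁻ zs
      #⁻-reject p zs = ≡.cong length (List.filter-reject (¬? ∘ P?) (λ ¬p → ¬p p))

      term : (a b : ℕ) (xs ys : List A) → K
      term a b xs ys = x ^ (a ℕ.+ #⁻ xs ∸ #⁻ ys) * y ^ (b ℕ.+ #⁺ xs ∸ #⁺ ys)

    -- Each entry of `xs` is either chosen or leaves one factor `x` or `y`, which gives a factor
    -- `1# + x` or `1# + y`. The offsets `a` and `b` make the induction possible: an entry that is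
    -- not chosen raises one of them by one.
    ∑-subsets : ∀ xs a b → ∑ (subsets xs) (term a b xs) ≈
      (x ^ a * (1# + x) ^ #⁻ xs) * (y ^ b * (1# + y) ^ #⁺ xs)
    ∑-subsets []       a b rewrite ℕ.+-identityʳ a | ℕ.+-identityʳ b =
      trans (+-identityʳ _) (*-cong (sym (*-identityʳ _)) (sym (*-identityʳ _)))
    ∑-subsets (z ∷ zs) a b = trans
      (trans (∑-++ (subsets zs) _) (+-congˡ (∑-map (z ∷_) (subsets zs))))
      (case P? z of λ where
        (yes p) → accept p
        (no ¬p) → reject ¬p)
      where
      X Y : K
      X = (1# + x) ^ #⁻ zs
      Y = (1# + y) ^ #⁺ zs

      pow-suc : ∀ {w k l} → k ≡ suc l → w ^ k ≈ w * w ^ l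
      pow-suc ≡.refl = refl

      sum : K
      sum = ∑ (subsets zs) (term a b (z ∷ zs)) + ∑ (subsets zs) (λ ys → term a b (z ∷ zs) (z ∷ ys))

      accept : P z → sum ≈ (x ^ a * (1# + x) ^ #⁻ (z ∷ zs)) * (y ^ b * (1# + y) ^ #⁺ (z ∷ zs))
      accept p = begin
        sum
          ≈⟨ +-cong
               (∑-cong (subsets zs) λ ys → reflexive (≡.cong₂ (λ q k → x ^ (a ℕ.+ q ∸ #⁻ ys) * y ^ (k ∸ #⁺ ys))
                 (#⁻-reject p zs) (≡.trans (≡.cong (b ℕ.+_) (#⁺-accept p zs)) (ℕ.+-suc b _))))
               -- With `z` chosen, minuend and subtrahend in the exponent of `y` both grow by one,
               -- and the two successors cancel under `_∸_` by computation.
               (∑-cong (subsets zs) λ ys → reflexive (≡.cong₂ (λ i j → x ^ i * y ^ j)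
                 (≡.cong₂ (λ q j → a ℕ.+ q ∸ j) (#⁻-reject p zs) (#⁻-reject p ys))
                 (≡.cong₂ _∸_ (≡.trans (≡.cong (b ℕ.+_) (#⁺-accept p zs)) (ℕ.+-suc b _)) (#⁺-accept p ys)))) ⟩
        ∑ (subsets zs) (term a (suc b) zs) + ∑ (subsets zs) (term a b zs)
          ≈⟨ +-cong (∑-subsets zs a (suc b)) (∑-subsets zs a b) ⟩
        (x ^ a * X) * (y * y ^ b * Y) + (x ^ a * X) * (y ^ b * Y)
          ≈⟨ solve 4 (λ U y B Y → U :* (y :* B :* Y) :+ U :* (B :* Y) := U :* (B :* ((con 1 :+ y) :* Y)))
                   refl (x ^ a * X) y (y ^ b) Y ⟩
        (x ^ a * X) * (y ^ b * ((1# + y) * Y))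
          ≈⟨ *-cong (*-congˡ (reflexive (≡.cong ((1# + x) ^_) (≡.sym (#⁻-reject p zs)))))
               (*-congˡ (sym (pow-suc (#⁺-accept p zs)))) ⟩
        (x ^ a * (1# + x) ^ #⁻ (z ∷ zs)) * (y ^ b * (1# + y) ^ #⁺ (z ∷ zs)) ∎

      reject : ¬ P z → sum ≈ (x ^ a * (1# + x) ^ #⁻ (z ∷ zs)) * (y ^ b * (1# + y) ^ #⁺ (z ∷ zs))
      reject ¬p = begin
        sum
          ≈⟨ +-cong
               (∑-cong (subsets zs) λ ys → reflexive (≡.cong₂ (λ k q → x ^ (k ∸ #⁻ ys) * y ^ (b ℕ.+ q ∸ #⁺ ys))
                 (≡.trans (≡.cong (a ℕ.+_) (#⁻-accept ¬p zs)) (ℕ.+-suc a _)) (#⁺-reject ¬p zs)))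
               (∑-cong (subsets zs) λ ys → reflexive (≡.cong₂ (λ i j → x ^ i * y ^ j)
                 (≡.cong₂ _∸_ (≡.trans (≡.cong (a ℕ.+_) (#⁻-accept ¬p zs)) (ℕ.+-suc a _)) (#⁻-accept ¬p ys))
                 (≡.cong₂ (λ q j → b ℕ.+ q ∸ j) (#⁺-reject ¬p zs) (#⁺-reject ¬p ys)))) ⟩
        ∑ (subsets zs) (term (suc a) b zs) + ∑ (subsets zs) (term a b zs)
          ≈⟨ +-cong (∑-subsets zs (suc a) b) (∑-subsets zs a b) ⟩
        (x * x ^ a * X) * (y ^ b * Y) + (x ^ a * X) * (y ^ b * Y)
          ≈⟨ solve 4 (λ U x A X → (x :* A :* X) :* U :+ (A :* X) :* U := (A :* ((con 1 :+ x) :* X)) :* U)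
                   refl (y ^ b * Y) x (x ^ a) X ⟩
        (x ^ a * ((1# + x) * X)) * (y ^ b * Y)
          ≈⟨ *-cong (*-congˡ (sym (pow-suc (#⁻-accept ¬p zs))))
               (*-congˡ (reflexive (≡.cong ((1# + y) ^_) (≡.sym (#⁺-reject ¬p zs))))) ⟩
        (x ^ a * (1# + x) ^ #⁻ (z ∷ zs)) * (y ^ b * (1# + y) ^ #⁺ (z ∷ zs)) ∎

  -- Makes the truncated subtraction in `neg~` exact when the list of covers is a member of
  -- `subsets (Cov↓ u)`.
  subsets-filter-≤ : ∀ {A : Set} {P : A → Set} (P? : Unary.Decidable P) (xs : List A) {ys} → ys ∈ subsets xs →
                     length (filter P? ys) ℕ.≤ length (filter P? xs)
  subsets-filter-≤ P? []       (here ≡.refl) = z≤n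
  subsets-filter-≤ P? (x ∷ xs) {ys} ys∈ with ∈-++⁻ (subsets xs) ys∈
  ... | inj₁ ys∈ = ℕ.≤-trans (subsets-filter-≤ P? xs ys∈) (filter-∷-≤ P? x xs)
    where
    filter-∷-≤ : ∀ {A : Set} {P : A → Set} (P? : Unary.Decidable P) x xs →
                 length (filter P? xs) ℕ.≤ length (filter P? (x ∷ xs))
    filter-∷-≤ P? x xs with does (P? x)
    ... | true  = ℕ.n≤1+n _
    ... | false = ℕ.≤-refl
  ... | inj₂ ys∈ with ∈-map⁻ (x ∷_) ys∈
  ... | zs , zs∈ , ≡.refl with does (P? x)
  ...   | true  = s≤s (subsets-filter-≤ P? xs zs∈)
  ...   | false = subsets-filter-≤ P? xs zs∈

  length-filter-¬ : ∀ {A : Set} {P : A → Set} (P? : Unary.Decidable P) (xs : List A) →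
                    length xs ≡ length (filter P? xs) ℕ.+ length (filter (¬? ∘ P?) xs)
  length-filter-¬ P? []       = ≡.refl
  length-filter-¬ P? (x ∷ xs) with P? x
  ... | yes _ = ≡.cong suc (length-filter-¬ P? xs)
  ... | no _  = ≡.trans (≡.cong suc (length-filter-¬ P? xs)) (≡.sym (ℕ.+-suc _ _))

-- The core label order in terms of first letters and tails

twos-⊆⁺ : ∀ {m} (v w : Vec (Fin 3) m) → (∀ i → lookup v i ≡ 2F → lookup w i ≡ 2F) → twos v ⊆ twos w
twos-⊆⁺ (2F ∷ v) (b ∷ w) two here rewrite two zero ≡.refl = here
twos-⊆⁺ (_ ∷ v)  (b ∷ w) two (there i∈) = there (twos-⊆⁺ v w (two ∘ suc) i∈)

twos-⊆⁻ : ∀ {m} (v w : Vec (Fin 3) m) → twos v ⊆ twos w → ∀ i → lookup v i ≡ 2F → lookup w i ≡ 2F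
twos-⊆⁻ (2F ∷ v) (2F ∷ w) v⊆w zero    eq = ≡.refl
twos-⊆⁻ (2F ∷ v) (0F ∷ w) v⊆w zero    eq = case v⊆w here of λ ()
twos-⊆⁻ (2F ∷ v) (1F ∷ w) v⊆w zero    eq = case v⊆w here of λ ()
twos-⊆⁻ (_ ∷ v)  (_ ∷ w)  v⊆w (suc i) eq = twos-⊆⁻ v w (Subset.drop-∷-⊆ v⊆w) i eq

∣T∣+∣∁T∣ : ∀ {m} (T : Subset m) → ∣ T ∣ ℕ.+ ∣ ∁ T ∣ ≡ m
∣T∣+∣∁T∣ []            = ≡.refl
∣T∣+∣∁T∣ (inside ∷ T)  = ≡.cong suc (∣T∣+∣∁T∣ T)
∣T∣+∣∁T∣ (outside ∷ T) = ≡.trans (ℕ.+-suc _ _) (≡.cong suc (∣T∣+∣∁T∣ T))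

module _ {m : ℕ} where
  open Hochschild (suc m)

  letters-⊆⁺ : ∀ {u v : Tri (suc m)} → twos (tail u) ⊆ twos (tail v) → ∀ i → letter u i ≡ 2F → letter v i ≡ 2F
  letters-⊆⁺ {u}              {v}              u⊆v zero    eq = contradiction eq (T2 u ≡.refl)
  letters-⊆⁺ {tri (_ ∷ _) _} {tri (_ ∷ _) _} u⊆v (suc i) eq = twos-⊆⁻ _ _ u⊆v i eq

  letters-⊆⁻ : ∀ {u v : Tri (suc m)} → (∀ i → letter u i ≡ 2F → letter v i ≡ 2F) → twos (tail u) ⊆ twos (tail v)
  letters-⊆⁻ {tri (_ ∷ w) _} {tri (_ ∷ w′) _} two = twos-⊆⁺ w w′ (two ∘ suc)

  ⊑⇒Above : ∀ {u v} → letter u zero ≡ 1F → u ⊑ v → letter v zero ≡ 1F × Above (tail u) (tail v)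
  ⊑⇒Above {u@(tri (_ ∷ _) _)} {v@(tri (_ ∷ _) _)} u₀ u⊑v = v₀ (letters zero) , letters ∘ suc
    where
    letters = ⊑⇒letters {m} {u} {v} (λ {c} → u⊑v {c}) u₀
    v₀ : letter v zero ≡ letter u zero ⊎ letter v zero ≡ 2F → letter v zero ≡ 1F
    v₀ (inj₁ eq) = ≡.trans eq u₀
    v₀ (inj₂ eq) = contradiction eq (T2 v ≡.refl)

  Above⇒⊑ : ∀ {u v} → letter u zero ≡ 1F → letter v zero ≡ 1F → Above (tail u) (tail v) → u ⊑ v
  Above⇒⊑ {u@(tri (_ ∷ _) _)} {v@(tri (_ ∷ _) _)} u₀ v₀ above {c} = ⇒⊑ {m} {u} {v}
    (λ i u≡2 → [ (λ v≡u → ≡.trans v≡u u≡2) , (λ v≡2 → v≡2) ]′ (letters i)) (λ _ → letters) {c}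
    where
    letters : ∀ i → letter v i ≡ letter u i ⊎ letter v i ≡ 2F
    letters zero    = inj₁ (≡.trans v₀ (≡.sym u₀))
    letters (suc i) = above i

  -- The 0s and 1s of `w` are inherited from `u`, so a violation of (T3) in `w` would already be one
  -- in `u`.
  Above⇒IsTriword : ∀ {u : Tri (suc m)} {w} → letter u zero ≡ 1F → Above (tail u) w → IsTriword (1F ∷ w)
  Above⇒IsTriword {u@(tri (_ ∷ _) _)} {w} u₀ above = mkIsTriword t2 (Ordered-∷⁺ (λ ()) ord)
    where
    t2 : ∀ i → toℕ i ≡ 0 → lookup (1F ∷ w) i ≢ 2F
    t2 zero _ ()
    same : ∀ i {a} → a ≢ 2F → lookup w i ≡ a → letter u (suc i) ≡ a
    same i a≢2 eq = [ (λ w≡u → ≡.trans (≡.sym w≡u) eq)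
                    , (λ w≡2 → contradiction (≡.trans (≡.sym eq) w≡2) a≢2) ]′ (above i)
    ord : Ordered w
    ord i j i<j w≡0 w≡1 = T3 u (s≤s i<j) (same i (λ ()) w≡0) (same j (λ ()) w≡1)

-- Both sides of the identity as sums over sets of 2s

module FTriangle {c ℓ} (R : CommutativeRing c ℓ) (m : ℕ)
  {rk : Tri (suc m) → ℕ} (isRank : IsRank (suc m) rk)
  {μ : Tri (suc m) → Tri (suc m) → ℤ} (isMöbius : IsMöbius (suc m) μ) where
  open CommutativeRing R hiding (zero) renaming (Carrier to K)
  open Triangles R
  open Sums R
  open WordSums R
  open Hochschild (suc m)
  open Algebra.Properties.Semiring.Mult semiring using (×-assoc-*) renaming (_×_ to _×ᴷ_)
  open Algebra.Properties.CommutativeMonoid.Mult +-commutativeMonoid using (×-congʳ)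
  open Algebra.Properties.CommutativeSemiring.Exp commutativeSemiring using (^-distrib-*)
  open Algebra.Properties.Semiring.Exp semiring using (^-homo-*; ^-congˡ)
  open Algebra.Solver.Ring.NaturalCoefficients.Default commutativeSemiring using (solve; _:=_; _:+_; _:*_; con)
  open Relation.Binary.Reasoning.Setoid setoid

  module Summands {Y Z : K} (Y+Z≈1 : Y + Z ≈ 1#) where

    wt : Subset m → K
    wt = weight Y+Z≈1

    W : ℕ → K
    W e = 1# - suc e ×ᴷ Y

    W+ : ∀ e → W e + suc e ×ᴷ Y ≈ 1#
    W+ e = trans (+-assoc _ _ _) (trans (+-congˡ (-‿inverseˡ _)) (+-identityʳ 1#))

    coefficient : Fin 3 → Subset m → K
    coefficient 0F      T = wt T * W ∣ ∁ T ∣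
    coefficient (suc _) T = Y * wt T

    f : Tri (suc m) → K
    f u = coefficient (letter u zero) (twos (tail u))

    -- The triwords above `u` are those whose 2s include `S`, wherever their 1s are. For each such
    -- `T`, the values of `f` at its one triword with first letter 0 and its `suc ∣ ∁ T ∣` triwords
    -- with first letter 1 add up to `wt T`, which leaves a binomial sum.
    ∑-↑-0 : ∀ u → letter u zero ≡ 0F →
            ∑ (triwords (suc m)) (λ v → guard (u ⊑? v) (f v)) ≈ Y ^ ∣ twos (tail u) ∣
    ∑-↑-0 u u₀ = begin
      ∑ (triwords (suc m)) (λ v → guard (u ⊑? v) (f v))
        ≈⟨ ∑-triwords m {g₀ = λ T → guard (S ⊆? T) (coefficient 0F T)}
             {λ _ T → guard (S ⊆? T) (coefficient 1F T)}
             (λ v v₀ → guard-⇔ (u ⊑? v) (S ⊆? twos (tail v)) (to v) (from v) λ _ →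
               reflexive (≡.cong (λ a → coefficient a (twos (tail v))) v₀))
             (λ v v₀ → guard-⇔ (u ⊑? v) (S ⊆? twos (tail v)) (to v) (from v) λ _ →
               reflexive (≡.cong (λ a → coefficient a (twos (tail v))) v₀)) ⟩
      ∑ˢ m (λ T → guard (S ⊆? T) (coefficient 0F T) +
                  (guard (S ⊆? T) (coefficient 1F T) + ∣ ∁ T ∣ ×ᴷ guard (S ⊆? T) (coefficient 1F T)))
        ≈⟨ ∑ˢ-cong m (λ T → trans (+-congˡ (guard-× (S ⊆? T) (suc ∣ ∁ T ∣)))
             (trans (sym (guard-+ (S ⊆? T))) (guard-cong (S ⊆? T) (term T)))) ⟩
      ∑ˢ m (λ T → guard (S ⊆? T) (wt T))
        ≈⟨ ∑ˢ-weight Y+Z≈1 S ⟩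
      Y ^ ∣ S ∣ ∎
      where
      S : Subset m
      S = twos (tail u)
      to : ∀ v → u ⊑ v → S ⊆ twos (tail v)
      to v u⊑v = letters-⊆⁻ {m} {u} {v} (⊑⇒two {m} {u} {v} (λ {c} → u⊑v {c}))
      from : ∀ v → S ⊆ twos (tail v) → u ⊑ v
      from v S⊆ {c} = NoOnes⇒⊑ {m} {u} {v} (0-head⇒NoOnes {m} {u} u₀) (letters-⊆⁺ {m} {u} {v} S⊆) {c}
      term : ∀ T → coefficient 0F T + suc ∣ ∁ T ∣ ×ᴷ coefficient 1F T ≈ wt T
      term T = begin
        wt T * W ∣ ∁ T ∣ + suc ∣ ∁ T ∣ ×ᴷ (Y * wt T)
          ≈⟨ +-congˡ (×-assoc-* (suc ∣ ∁ T ∣) Y (wt T)) ⟨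
        wt T * W ∣ ∁ T ∣ + (suc ∣ ∁ T ∣ ×ᴷ Y) * wt T
          ≈⟨ +-congˡ (*-comm _ _) ⟩
        wt T * W ∣ ∁ T ∣ + wt T * (suc ∣ ∁ T ∣ ×ᴷ Y)
          ≈⟨ distribˡ _ _ _ ⟨
        wt T * (W ∣ ∁ T ∣ + suc ∣ ∁ T ∣ ×ᴷ Y)
          ≈⟨ trans (*-congˡ (W+ ∣ ∁ T ∣)) (*-identityʳ _) ⟩
        wt T ∎

    -- Only triwords with first letter 1 lie above `u`, and there the tail ranges over all words
    -- `Above` its own. The factor `Y` in `coefficient` then matches the rank, which the leading 1
    -- raises by one.
    ∑-↑-1 : ∀ u → letter u zero ≡ 1F →
            ∑ (triwords (suc m)) (λ v → guard (u ⊑? v) (f v)) ≈ Y ^ suc ∣ twos (tail u) ∣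
    ∑-↑-1 u u₀ = begin
      ∑ (triwords (suc m)) G
        ≈⟨ ∑-triwords-head m ⟩
      ∑ (words m) _ + ∑ (words m) _
        ≈⟨ +-cong (∑-zero (words m) λ w → maybe-toTri {G = G} (0F ∷ w)
                     (λ p → guard-no (u ⊑? tri (0F ∷ w) p) λ u⊑v →
                        case proj₁ (⊑⇒Above {m} {u} {tri (0F ∷ w) p} u₀ (λ {c} → u⊑v {c})) of λ ())
                     (λ _ → refl))
                  (∑-cong (words m) λ w → maybe-toTri {G = G} (1F ∷ w)
                     (λ p → guard-⇔ (u ⊑? tri (1F ∷ w) p) (above? (tail u) w)
                        (λ u⊑v → proj₂ (⊑⇒Above {m} {u} {tri (1F ∷ w) p} u₀ (λ {c} → u⊑v {c})))
                        (λ above {c} → Above⇒⊑ {m} {u} {tri (1F ∷ w) p} u₀ ≡.refl above {c}) (λ _ → refl))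
                     (λ ¬p → sym (guard-no (above? (tail u) w) λ above →
                        ¬p (Above⇒IsTriword {m} {u} u₀ above)))) ⟩
      0# + ∑ (words m) (λ w → guard (above? (tail u) w) (Y * wt (twos w)))
        ≈⟨ trans (+-identityˡ _) (trans (∑-cong (words m) λ w → guard-*ˡ (above? (tail u) w)) (∑-*ˡ (words m))) ⟩
      Y * ∑ (words m) (λ w → guard (above? (tail u) w) (wt (twos w)))
        ≈⟨ *-congˡ (∑-above Y+Z≈1 (tail u)) ⟩
      Y ^ suc ∣ twos (tail u) ∣ ∎
      where
      G : Tri (suc m) → K
      G v = guard (u ⊑? v) (f v)

    ∑-↑ : ∀ u → ∑ (triwords (suc m)) (λ v → guard (u ⊑? v) (f v)) ≈ Y ^ rk u
    ∑-↑ u = [ (λ u₀ → trans (∑-↑-0 u u₀) (reflexive (≡.cong (Y ^_) (≡.sym (rank-0 isRank {u} u₀)))))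
            , [ (λ u₀ → trans (∑-↑-1 u u₀) (reflexive (≡.cong (Y ^_) (≡.sym (rank-1 isRank {u} u₀)))))
              , (λ u₀ → contradiction u₀ (T2 u ≡.refl)) ]′ ]′ (≡0⊎≡1⊎≡2 (letter u zero))

    ∑-μ : ∀ u → ∑ (triwords (suc m)) (λ v → fromℤ (μ u v) * Y ^ rk v) ≈ f u
    ∑-μ = Inversion.inversion (Tri-finite (suc m)) _⊑?_
      (λ {u} {c} Ψc → Ψc) (λ {u} {v} {w} u⊑v v⊑w {c} Ψc → v⊑w {c} (u⊑v {c} Ψc))
      (λ {u} {v} u⊑v v⊑u → ⊑-antisym {m} {u} {v} (λ {c} → u⊑v {c}) (λ {c} → v⊑u {c}))
      isMöbius f (λ v → Y ^ rk v) ∑-↑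

    M≈ : ∀ X → M-triangle (suc m) rk μ X Y ≈ ∑ (triwords (suc m)) (λ u → X ^ rk u * f u)
    M≈ X = ∑-cong (triwords (suc m)) λ u → trans
      (∑-cong (triwords (suc m)) λ v → trans (*-congʳ (*-comm _ _)) (*-assoc _ _ _))
      (trans (∑-*ˡ (triwords (suc m))) (*-congˡ (∑-μ u)))

  RHS : K → K → Tri (suc m) → K
  RHS x y u = ∑ (subsets (Cov↓ u)) (λ A → x ^ (suc m ∸ length A ∸ neg~ u A) * y ^ neg~ u A)

  -- Here `a` is `n` minus the number of lower covers. Covers in `A` with an atom as label are
  -- counted once in `length A` and subtracted once in `neg~ u A`, so they drop out of the exponent
  -- of `x`, which is `a` plus the number of other covers outside `A`.
  ∑-cores : ∀ u {a p q} → CoverCounts u p q → suc m ≡ a ℕ.+ q ℕ.+ p → ∀ x y →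
            RHS x y u ≈ (x ^ a * (1# + x) ^ q) * (1# + y) ^ p
  ∑-cores u {a} {p} {q} counts n≡ x y = begin
    RHS x y u
      ≈⟨ ∑-cong-∈ (subsets (Cov↓ u)) (λ {A} A∈ →
           reflexive (≡.cong₂ (λ i j → x ^ i * y ^ j) (x-exponent A∈) (y-exponent A))) ⟩
    ∑ (subsets (Cov↓ u)) (λ A → x ^ (a ℕ.+ #⁻ (Cov↓ u) ∸ #⁻ A) * y ^ (0 ℕ.+ #⁺ (Cov↓ u) ∸ #⁺ A))
      ≈⟨ ∑-subsets P? x y (Cov↓ u) a 0 ⟩
    (x ^ a * (1# + x) ^ #⁻ (Cov↓ u)) * (1# * (1# + y) ^ #⁺ (Cov↓ u))
      ≈⟨ *-cong (*-congˡ (reflexive (≡.cong ((1# + x) ^_) nonatoms≡)))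
           (trans (*-identityˡ _) (reflexive (≡.cong ((1# + y) ^_) atoms≡))) ⟩
    (x ^ a * (1# + x) ^ q) * (1# + y) ^ p ∎
    where
    open CoverCounts counts
    P? : ∀ u′ → Dec (AtomLabel u′ u)
    P? u′ = atomLabel? u′ u
    #⁺ #⁻ : List (Tri (suc m)) → ℕ
    #⁺ A = length (filter P? A)
    #⁻ A = length (filter (¬? ∘ P?) A)

    y-exponent : ∀ A → neg~ u A ≡ #⁺ (Cov↓ u) ∸ #⁺ A
    y-exponent A = ≡.cong (_∸ #⁺ A) (≡.trans neg≡ (≡.sym atoms≡))

    x-exponent : ∀ {A} → A ∈ subsets (Cov↓ u) → suc m ∸ length A ∸ neg~ u A ≡ a ℕ.+ #⁻ (Cov↓ u) ∸ #⁻ A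
    x-exponent {A} A∈ = ≡R.begin
      suc m ∸ length A ∸ neg~ u A
        ≡R.≡⟨ ℕ.∸-+-assoc (suc m) (length A) (neg~ u A) ⟩
      suc m ∸ (length A ℕ.+ neg~ u A)
        ≡R.≡⟨ ≡.cong₂ _∸_ (≡.trans n≡ (≡.trans (ℕ.+-comm (a ℕ.+ q) p)
                             (≡.cong (λ q → p ℕ.+ (a ℕ.+ q)) (≡.sym nonatoms≡)))) sum ⟩
      p ℕ.+ (a ℕ.+ #⁻ (Cov↓ u)) ∸ (p ℕ.+ #⁻ A)
        ≡R.≡⟨ ℕ.[m+n]∸[m+o]≡n∸o p _ _ ⟩
      a ℕ.+ #⁻ (Cov↓ u) ∸ #⁻ A ≡R.∎
      where
      module ≡R = ≡.≡-Reasoning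
      sum : length A ℕ.+ neg~ u A ≡ p ℕ.+ #⁻ A
      sum = ≡R.begin
        length A ℕ.+ neg~ u A
          ≡R.≡⟨ ≡.cong₂ ℕ._+_ (≡.trans (length-filter-¬ P? A) (ℕ.+-comm (#⁺ A) (#⁻ A))) (y-exponent A) ⟩
        #⁻ A ℕ.+ #⁺ A ℕ.+ (#⁺ (Cov↓ u) ∸ #⁺ A)
          ≡R.≡⟨ ℕ.+-assoc (#⁻ A) _ _ ⟩
        #⁻ A ℕ.+ (#⁺ A ℕ.+ (#⁺ (Cov↓ u) ∸ #⁺ A))
          ≡R.≡⟨ ≡.cong (#⁻ A ℕ.+_) (≡.trans (ℕ.m+[n∸m]≡n (subsets-filter-≤ P? (Cov↓ u) A∈)) atoms≡) ⟩
        #⁻ A ℕ.+ p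
          ≡R.≡⟨ ℕ.+-comm (#⁻ A) p ⟩
        p ℕ.+ #⁻ A ≡R.∎

  module _ (x y : K) where

    -- The factors `1#` here and in `r₁` are the ends of the powers `(1# + x) ^ 0` and
    -- `(1# + x) ^ 1`, kept so that the values have the form given by `∑-cores` by computation.
    r₀ : Subset m → K
    r₀ T = (x ^ suc ∣ ∁ T ∣ * 1#) * (1# + y) ^ ∣ T ∣

    r₁ : Bool → Subset m → K
    r₁ true  T = (x ^ ∣ ∁ T ∣ * 1#) * (1# + y) ^ suc ∣ T ∣
    r₁ false T = (x ^ ∣ ∁ T ∣ * ((1# + x) * 1#)) * (1# + y) ^ ∣ T ∣

    ∑-RHS : ∑ (triwords (suc m)) (RHS x y) ≈ ∑ˢ m (λ T → r₀ T + (r₁ true T + ∣ ∁ T ∣ ×ᴷ r₁ false T))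
    ∑-RHS = ∑-triwords m {g₀ = r₀} {r₁}
      (λ u u₀ → ∑-cores u {suc (e u)} {t u} {0} (coverCounts-0 u u₀)
        (≡.cong suc (≡.sym (≡.trans (≡.cong (ℕ._+ t u) (ℕ.+-identityʳ (e u))) (total u)))) x y)
      (λ u u₀ → head-1 u u₀ (noOnes? (tail u)))
      where
      t e : Tri (suc m) → ℕ
      t u = ∣ twos (tail u) ∣
      e u = ∣ ∁ (twos (tail u)) ∣

      total : ∀ u → e u ℕ.+ t u ≡ m
      total u = ≡.trans (ℕ.+-comm (e u) (t u)) (∣T∣+∣∁T∣ (twos (tail u)))

      head-1 : ∀ u → letter u zero ≡ 1F → (none? : Dec (NoOnes (tail u))) →
               RHS x y u ≈ r₁ (does none?) (twos (tail u))
      head-1 u u₀ (yes none) = ∑-cores u {e u} {suc (t u)} {0} (coverCounts-1 u u₀ none)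
        (≡.sym (≡.trans (≡.cong (ℕ._+ suc (t u)) (ℕ.+-identityʳ (e u)))
                        (≡.trans (ℕ.+-suc (e u) (t u)) (≡.cong suc (total u))))) x y
      head-1 u u₀ (no ¬none) = ∑-cores u {e u} {t u} {1} (coverCounts-1⋯1 u last)
        (≡.sym (≡.trans (≡.cong (ℕ._+ t u) (ℕ.+-comm (e u) 1)) (≡.cong suc (total u)))) x y
        where
        last = [ (λ none → contradiction none ¬none) , (λ last → last) ]′ (noOnes⊎lastOne (tail u))

    module _ {y⁻¹ d⁻¹ : K} (y*y⁻¹≈1 : y * y⁻¹ ≈ 1#) (d*d⁻¹≈1 : (y - x) * d⁻¹ ≈ 1#) where
      d X Y Z : K
      d = y - x
      X = (y + 1#) * d⁻¹
      Y = d * y⁻¹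
      Z = x * y⁻¹

      d+x≈y : d + x ≈ y
      d+x≈y = trans (+-assoc _ _ _) (trans (+-congˡ (-‿inverseˡ x)) (+-identityʳ y))

      Y+Z≈1 : Y + Z ≈ 1#
      Y+Z≈1 = trans (sym (distribʳ y⁻¹ d x)) (trans (*-congʳ d+x≈y) y*y⁻¹≈1)

      cancel-y⁻¹ : ∀ k → y * (k * y⁻¹) ≈ k
      cancel-y⁻¹ k = trans (solve 3 (λ y k i → y :* (k :* i) := (y :* i) :* k) refl y k y⁻¹)
        (trans (*-congʳ y*y⁻¹≈1) (*-identityˡ k))

      yXY≈y+1 : y * (X * Y) ≈ y + 1#
      yXY≈y+1 = trans
        (solve 5 (λ y s i d j → y :* ((s :* i) :* (d :* j)) := (y :* (s :* j)) :* (d :* i)) 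
          refl y (y + 1#) d⁻¹ d y⁻¹)
        (trans (*-cong (cancel-y⁻¹ (y + 1#)) d*d⁻¹≈1) (*-identityʳ _))

      open Summands Y+Z≈1

      l₀ l₁ : Subset m → K
      l₀ T = y ^ suc m * (X ^ ∣ T ∣ * (wt T * W ∣ ∁ T ∣))
      l₁ T = y ^ suc m * (X ^ suc ∣ T ∣ * (Y * wt T))

      ∑-LHS : F-triangle (suc m) rk μ x y y⁻¹ d⁻¹ ≈ ∑ˢ m (λ T → l₀ T + (l₁ T + ∣ ∁ T ∣ ×ᴷ l₁ T))
      ∑-LHS = trans (*-congˡ (M≈ X)) (trans (sym (∑-*ˡ (triwords (suc m))))
        (∑-triwords m {g₀ = l₀} {λ _ → l₁}
          (λ u u₀ → *-congˡ (*-cong (reflexive (≡.cong (X ^_) (rank-0 isRank {u} u₀)))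
             (reflexive (≡.cong (λ a → coefficient a (twos (tail u))) u₀))))
          (λ u u₀ → *-congˡ (*-cong (reflexive (≡.cong (X ^_) (rank-1 isRank {u} u₀)))
             (reflexive (≡.cong (λ a → coefficient a (twos (tail u))) u₀))))))

      C : Subset m → K
      C T = (1# + y) ^ ∣ T ∣ * x ^ ∣ ∁ T ∣

      -- Since `m` is `∣ T ∣` plus `∣ ∁ T ∣`, each position of the tail receives one factor `y`: a 2
      -- gives `y * (X * Y)`, that is `y + 1#`, and any other position gives `y * Z`, that is `x`.
      -- The remaining factor of `y ^ suc m` belongs to the first letter.
      clear : ∀ T → y ^ m * (X ^ ∣ T ∣ * wt T) ≈ C T
      clear T = begin
        y ^ m * (X ^ t * (Y ^ t * Z ^ e))
          ≈⟨ *-congʳ (trans (reflexive (≡.cong (y ^_) (≡.sym (∣T∣+∣∁T∣ T)))) (^-homo-* y t e)) ⟩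
        (y ^ t * y ^ e) * (X ^ t * (Y ^ t * Z ^ e))
          ≈⟨ solve 5 (λ p q r s v → (p :* q) :* (r :* (s :* v)) := (p :* (r :* s)) :* (q :* v)) refl
               (y ^ t) (y ^ e) (X ^ t) (Y ^ t) (Z ^ e) ⟩
        (y ^ t * (X ^ t * Y ^ t)) * (y ^ e * Z ^ e)
          ≈⟨ *-cong (trans (*-congˡ (sym (^-distrib-* X Y t))) (sym (^-distrib-* y (X * Y) t)))
                   (sym (^-distrib-* y Z e)) ⟩
        (y * (X * Y)) ^ t * (y * Z) ^ e
          ≈⟨ *-cong (^-congˡ t (trans yXY≈y+1 (+-comm y 1#))) (^-congˡ e (cancel-y⁻¹ x)) ⟩
        C T ∎
        where
        t = ∣ T ∣
        e = ∣ ∁ T ∣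

      -- The value of `y * W e` with its subtraction moved across, so that `summand` can be computed
      -- in a commutative semiring.
      yW : ∀ e → y * W e + (1# + e ×ᴷ 1#) * d ≈ y
      yW e = begin
        y * W e + (1# + e ×ᴷ 1#) * d
          ≈⟨ +-congˡ (*-congˡ (cancel-y⁻¹ d)) ⟨
        y * W e + (1# + e ×ᴷ 1#) * (y * Y)
          ≈⟨ solve 4 (λ y w s Y → y :* w :+ s :* (y :* Y) := y :* (w :+ s :* Y)) refl y (W e) (suc e ×ᴷ 1#) Y ⟩
        y * (W e + suc e ×ᴷ 1# * Y)
          ≈⟨ *-congˡ (+-congˡ (trans (×-assoc-* (suc e) 1# Y) (×-congʳ (suc e) (*-identityˡ Y)))) ⟩
        y * (W e + suc e ×ᴷ Y)
          ≈⟨ trans (*-congˡ (W+ e)) (*-identityʳ y) ⟩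
        y ∎

      summand : ∀ T → l₀ T + (l₁ T + ∣ ∁ T ∣ ×ᴷ l₁ T) ≈ r₀ T + (r₁ true T + ∣ ∁ T ∣ ×ᴷ r₁ false T)
      summand T = begin
        l₀ T + (l₁ T + e ×ᴷ l₁ T)
          ≈⟨ +-cong l₀≈ (+-cong l₁≈ (trans (×-1 (l₁ T)) (*-congˡ l₁≈))) ⟩
        C T * (y * W e) + (C T * (y + 1#) + E * (C T * (y + 1#)))
          ≈⟨ solve 4 (λ C w y E → C :* w :+ (C :* (y :+ con 1) :+ E :* (C :* (y :+ con 1)))
                   := C :* (w :+ (con 1 :+ E) :* (y :+ con 1))) refl (C T) (y * W e) y E ⟩
        C T * (y * W e + (1# + E) * (y + 1#))
          -- Writing `y` as `d + x` isolates the multiple of `d` that `yW` absorbs; no denominator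
          -- and no subtraction is left after that.
          ≈⟨ *-congˡ (+-congˡ (*-congˡ (+-congʳ d+x≈y))) ⟨
        C T * (y * W e + (1# + E) * (d + x + 1#))
          ≈⟨ *-congˡ (solve 4 (λ w E d x → w :+ (con 1 :+ E) :* (d :+ x :+ con 1)
                   := (w :+ (con 1 :+ E) :* d) :+ (con 1 :+ E) :* (x :+ con 1)) refl (y * W e) E d x) ⟩
        C T * ((y * W e + (1# + E) * d) + (1# + E) * (x + 1#))
          ≈⟨ *-congˡ (+-congʳ (yW e)) ⟩
        ((1# + y) ^ t * x ^ e) * (y + (1# + E) * (x + 1#))
          ≈⟨ solve 5 (λ B x P y E → (B :* P) :* (y :+ (con 1 :+ E) :* (x :+ con 1)) :=
               ((x :* P) :* con 1) :* B :+ ((P :* con 1) :* ((con 1 :+ y) :* B)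
                 :+ E :* ((P :* ((con 1 :+ x) :* con 1)) :* B))) refl ((1# + y) ^ t) x (x ^ e) y E ⟩
        r₀ T + (r₁ true T + E * r₁ false T)
          ≈⟨ +-congˡ (+-congˡ (×-1 (r₁ false T))) ⟨
        r₀ T + (r₁ true T + e ×ᴷ r₁ false T) ∎
        where
        t = ∣ T ∣
        e = ∣ ∁ T ∣
        E = e ×ᴷ 1#
        ×-1 : ∀ k → e ×ᴷ k ≈ E * k
        ×-1 k = sym (trans (×-assoc-* e 1# k) (×-congʳ e (*-identityˡ k)))
        l₀≈ : l₀ T ≈ C T * (y * W e)
        l₀≈ = trans (solve 5 (λ y p q r s → (y :* p) :* (q :* (r :* s)) := (p :* (q :* r)) :* (y :* s)) refl
                       y (y ^ m) (X ^ t) (wt T) (W e)) (*-congʳ (clear T))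
        l₁≈ : l₁ T ≈ C T * (y + 1#)
        l₁≈ = trans (solve 6 (λ y p x q Y r → (y :* p) :* ((x :* q) :* (Y :* r)) := (p :* (q :* r)) :* (y :* (x :* Y)))
                       refl
                       y (y ^ m) X (X ^ t) Y (wt T)) (*-cong (clear T) yXY≈y+1)

      F≈∑-RHS : F-triangle (suc m) rk μ x y y⁻¹ d⁻¹ ≈ ∑ (triwords (suc m)) (RHS x y)
      F≈∑-RHS = trans ∑-LHS (trans (∑ˢ-cong m summand) (sym ∑-RHS))

proposition6p13 : ∀ {c ℓ} (n : ℕ) → n > 0 →
    (rk : Tri n → ℕ) → IsRank n rk →
    (μ : Tri n → Tri n → ℤ) → IsMöbius n μ →
    (R : CommutativeRing c ℓ) →
    let open CommutativeRing R
        open Triangles R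
        open Hochschild n
    in (x y y⁻¹ d⁻¹ : Carrier) → y * y⁻¹ ≈ 1# → (y - x) * d⁻¹ ≈ 1# →
       F-triangle n rk μ x y y⁻¹ d⁻¹
         ≈ ∑ (triwords n) (λ u → ∑ (subsets (Cov↓ u)) (λ A →
             x ^ (n ∸ length A ∸ neg~ u A) * y ^ neg~ u A))
proposition6p13 (suc m) _ rk isRank μ isMöbius R x y y⁻¹ d⁻¹ =
  FTriangle.F≈∑-RHS R m isRank isMöbius x y
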